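{- For any integers $c\ge0$ and $n\ge1$, $$\dim{\mathbf{Hi}_{\underline{c}}}^!(n)=\mathrm{cat}_c(n),$$ where $\mathrm{cat}_c(n):=\frac{1}{cn+1}\binom{cn+n}{n}$ is the $n$-th $c$-Fuss-Catalan number.
   Context: $\mathbb{N}=\{0,1,2,\dots\}$ and $\mathbb{K}$ is a field of characteristic zero. All operads are nonsymmetric operads in $\mathbb{K}$-vector spaces; $\mathcal{O}(n)$ is the arity-$n$ component of $\mathcal{O}$. Fix $c\ge0$. For a word $w$ on $\mathbb{N}$, $\ell(w)$ is its length, $w(i)$ its $i$-th letter, $\epsilon$ the empty word, $|w|:=\ell(w)+1$. $\mathsf{Cl}_{\underline{c}}$ is the set of all words on $\{0,\dots,c\}$, and $\mathsf{Hi}_{\underline{c}}$ is its subset of weakly increasing words. $\mathbf{Cl}_{\underline{c}}$ is the operad with basis $\{\mathsf{E}_w:w\in\mathsf{Cl}_{\underline{c}}\}$, $\mathsf{E}_w$ of arity $|w|$, with $\mathsf{E}_u\circ_i\mathsf{E}_v:=\mathsf{E}_{u(1)\cdots u(i-1)\,v\,u(i)\cdots u(\ell(u))}$ for $1\le i\le|u|$, and unit $\mathsf{E}_\epsilon$. For words of the same length, $u\preccurlyeq v$ iff $u(j)\le v(j)$ for all $j$. The $\mathsf{F}$-basis of $\mathbf{Cl}_{\underline{c}}$ is determined by $\mathsf{E}_w=\sum_{w'\in\mathsf{Cl}_{\underline{c}},\,w\preccurlyeq w'}\mathsf{F}_{w'}$ (Möbius inversion). The span of $\{\mathsf{F}_w:w\in\mathsf{Cl}_{\underline{c}}\setminus\mathsf{Hi}_{\underline{c}}\}$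 is an operad ideal, and $\mathbf{Hi}_{\underline{c}}$ is the quotient operad; for $w\in\mathsf{Hi}_{\underline{c}}$, $\mathsf{E}_w\in\mathbf{Hi}_{\underline{c}}$ denotes the image of $\mathsf{E}_w$. The operad $\mathbf{Hi}_{\underline{c}}$ is binary and quadratic: it is the quotient of the free operad on the arity-$2$ generators $\mathsf{E}_0,\dots,\mathsf{E}_c$ by the ideal generated by the space $R$ (in arity $3$ of the free operad) spanned by $\mathsf{E}_a\circ_1\mathsf{E}_b-\mathsf{E}_b\circ_2\mathsf{E}_{a'}$ for $0\le a,a'\le b\le c$ and $\mathsf{E}_b\circ_1\mathsf{E}_a-\mathsf{E}_a\circ_2\mathsf{E}_b$ for $0\le a<b\le c$. Its Koszul dual ${\mathbf{Hi}_{\underline{c}}}^!$ is the quotient of the free operad on the dual arity-$2$ generators $\mathsf{E}^\star_0,\dots,\mathsf{E}^\star_c$ by the ideal generated by the annihilator $R^\perp$ of $R$ for the pairing in arity $3$ given by $\langle\mathsf{E}^\star_x\circ_i\mathsf{E}^\star_y,\mathsf{E}_{x'}\circ_{i'}\mathsf{E}_{y'}\rangle:=1$ if $(x,y,i)=(x',y',i')$ and $i=1$, $-1$ if $(x,y,i)=(x',y',i')$ and $i=2$, and $0$ otherwise. -}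

module Defs where

open import Algebra.Apartness.Bundles using (HeytingCommutativeRing; HeytingField)
open import Algebra.Bundles using (CommutativeMonoid; CommutativeRing)
open import Algebra.Module.Bundles using (Module)
open import Algebra.Module.Structures.Biased using (IsModuleFromLeft)
import Algebra.Module.Properties as ModuleProperties
import Algebra.Properties.AbelianGroup as AbelianGroupProperties
import Algebra.Properties.CommutativeMonoid.Sum as Sum
import Algebra.Properties.CommutativeSemigroup as CommutativeSemigroupProperties
import Algebra.Properties.Monoid.Mult as Mult
import Algebra.Properties.Ring as RingProperties
open import Data.Bool.Base using (if_then_else_)
open import Data.Fin.Base as Fin using (Fin; splitAt; cast)
open import Data.Fin.Patterns using (0F; 1F)
import Data.Fin.Properties as Fin
open import Data.List.Base using (List; []; _∷_; [_]; _++_; map; cartesianProductWith)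
open import Data.Nat.Base
  using (ℕ; zero; suc; pred; _+_; _*_; _∸_; _/_; _!)
open import Data.Nat.Combinatorics using (_C_; nCk≡n!/k![n-k]!; k![n∸k]!∣n!)
open import Data.Nat.Coprimality using (Coprime; coprime-divisor)
open import Data.Nat.DivMod using (m/n*n≡m)
open import Data.Nat.Divisibility
  using (_∣_; divides; ∣1⇒≡1; ∣m+n∣m⇒∣n; ∣n⇒∣m*n)
import Data.Nat.Properties as ℕₚ
open ℕₚ using (m+n∸n≡m; m≤n+m; _!*_!≢0)
open import Data.Nat.Tactic.RingSolver using (solve-∀)
open import Data.Product.Base using (_×_; _,_; ∃; map₁)
open import Data.Sum.Base using (inj₁; inj₂)
open import Data.Tree.Binary using (Tree; leaf; node; #leaves)
open import Data.Unit.Base using (⊤; tt)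
open import Data.Vec.Functional using (Vector)
open import Level using (Level; _⊔_)
open import Relation.Binary.Core using (Rel)
open import Relation.Binary.Definitions using (DecidableEquality)
import Relation.Binary.Reasoning.Setoid as SetoidReasoning
open import Relation.Binary.PropositionalEquality.Core
  using (_≡_; refl; sym; trans; cong; cong₂; subst)
open import Relation.Binary.PropositionalEquality.Properties using (module ≡-Reasoning)
open import Relation.Nullary.Decidable using (does; yes; no)
open import Relation.Nullary.Negation using (¬_)
open import Relation.Unary using (Pred; _∈_)

private
  variable
    r ℓr m ℓm p : Level

cat : ℕ → ℕ → ℕ
cat c n = ((c * n + n) C n) / suc (c * n)

-- The division in `cat` leaves no remainder.
cat-exact : ∀ c n → cat c n * suc (c * n) ≡ (c * n + n) C n
cat-exact c n = m/n*n≡m (suc-cn∣C n)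
  where
  open ≡-Reasoning

  C-factorial : ∀ a b → ((a + b) C b) * (b ! * a !) ≡ (a + b) !
  C-factorial a b = begin
    ((a + b) C b) * (b ! * a !)
      ≡⟨ cong (λ x → ((a + b) C b) * (b ! * x !)) (m+n∸n≡m a b) ⟨
    ((a + b) C b) * (b ! * (a + b ∸ b) !)
      ≡⟨ cong (_* (b ! * (a + b ∸ b) !)) (nCk≡n!/k![n-k]! (m≤n+m b a)) ⟩
    ((a + b) ! / (b ! * (a + b ∸ b) !)) * (b ! * (a + b ∸ b) !)
      ≡⟨ m/n*n≡m (k![n∸k]!∣n! (m≤n+m b a)) ⟩
    (a + b) ! ∎
    where instance _ = b !* (a + b ∸ b) !≢0

  C-absorb : ∀ a b → suc b * ((a + suc b) C suc b) ≡ ((suc a + b) C b) * suc a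
  C-absorb a b = ℕₚ.*-cancelʳ-≡ _ _ (b ! * a !) {{b !* a !≢0}} (begin
    suc b * x * (b ! * a !)       ≡⟨ rearrange₁ (suc b) x (b !) (a !) ⟩
    x * (suc b * b ! * a !)       ≡⟨ C-factorial a (suc b) ⟩
    (a + suc b) !                 ≡⟨ cong _! (ℕₚ.+-suc a b) ⟩
    (suc a + b) !                 ≡⟨ C-factorial (suc a) b ⟨
    y * (b ! * (suc a * a !))     ≡⟨ rearrange₂ y (b !) (suc a) (a !) ⟩
    y * suc a * (b ! * a !)       ∎)
    where
    x = (a + suc b) C suc b
    y = (suc a + b) C b
    rearrange₁ : ∀ s x u v → s * x * (u * v) ≡ x * (s * u * v)
    rearrange₁ = solve-∀
    rearrange₂ : ∀ y u s v → y * (u * (s * v)) ≡ y * s * (u * v)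
    rearrange₂ = solve-∀

  coprime : ∀ k → Coprime (suc (c * k)) k
  coprime k {d} (d∣1+ck , d∣k) =
    ∣1⇒≡1 (∣m+n∣m⇒∣n (subst (d ∣_) (ℕₚ.+-comm 1 (c * k)) d∣1+ck) (∣n⇒∣m*n c d∣k))

  suc-cn∣C : ∀ n → suc (c * n) ∣ ((c * n + n) C n)
  suc-cn∣C zero    rewrite ℕₚ.*-zeroʳ c = divides 1 refl
  suc-cn∣C (suc k) = coprime-divisor (coprime (suc k))
    (divides ((suc (c * suc k) + k) C k) (C-absorb (c * suc k) k))

module _ {R : CommutativeRing r ℓr} (M : Module R m ℓm) where
  open CommutativeRing R using (Carrier; _≈_; 0#; 1#; -_; -‿inverseʳ)
  open Module M

  HasDimension : ℕ → Set (r ⊔ ℓr ⊔ m ⊔ ℓm)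
  HasDimension d = ∃ λ (b : Vector Carrierᴹ d) →
      (∀ v → ∃ λ (k : Vector Carrier d) → v ≈ᴹ ∑ (λ i → k i *ₗ b i))
    × (∀ (k : Vector Carrier d) → ∑ (λ i → k i *ₗ b i) ≈ᴹ 0ᴹ → ∀ i → k i ≈ 0#)
    where open Sum +ᴹ-commutativeMonoid renaming (sum to ∑)

  data Span (P : Pred Carrierᴹ p) : Pred Carrierᴹ (r ⊔ m ⊔ ℓm ⊔ p) where
    generator : ∀ {x} → x ∈ P → x ∈ Span P
    resp      : ∀ {x y} → x ≈ᴹ y → x ∈ Span P → y ∈ Span P
    zeroᴹ     : 0ᴹ ∈ Span P
    plus      : ∀ {x y} → x ∈ Span P → y ∈ Span P → x +ᴹ y ∈ Span P
    scale     : ∀ k {x} → x ∈ Span P → k *ₗ x ∈ Span P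

  record IsSubmodule (N : Pred Carrierᴹ p) : Set (r ⊔ m ⊔ ℓm ⊔ p) where
    field
      ∈-resp : ∀ {x y} → x ≈ᴹ y → x ∈ N → y ∈ N
      0∈     : 0ᴹ ∈ N
      +∈     : ∀ {x y} → x ∈ N → y ∈ N → x +ᴹ y ∈ N
      *ₗ∈    : ∀ k {x} → x ∈ N → k *ₗ x ∈ N

  -- M / N: the carrier of M, with x and y identified when x - y ∈ N.
  quotient : {N : Pred Carrierᴹ p} → IsSubmodule N → Module R m p
  quotient {p} {N} isSubmodule = record
    { isModule = IsModuleFromLeft.isModule {commutativeRing = R} record
      { isLeftModule = record
        { isLeftSemimodule = record
          { +ᴹ-isCommutativeMonoid = record
            { isMonoid = record
              { isSemigroup = record
                { isMagma = record
                  { isEquivalence = record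
                    { refl  = ≈⇒∼ ≈ᴹ-refl
                    ; sym   = λ {x} {y} x∼y →
                        ∈-resp (≈ᴹ-trans (-[x-y] x y)
                                  (≈ᴹ-trans (+ᴹ-comm _ _) (+ᴹ-congʳ (-ᴹ-involutive y))))
                          (-∈ x∼y)
                    ; trans = λ {x} {y} {z} x∼y y∼z →
                        ∈-resp (telescope x y z) (+∈ x∼y y∼z)
                    }
                  ; ∙-cong = λ {x} {y} {u} {v} x∼y u∼v →
                      ∈-resp (swap x y u v) (+∈ x∼y u∼v)
                  }
                ; assoc = λ x y z → ≈⇒∼ (+ᴹ-assoc x y z)
                }
              ; identity = (λ x → ≈⇒∼ (+ᴹ-identityˡ x)) , (λ x → ≈⇒∼ (+ᴹ-identityʳ x))
              }
            ; comm = λ x y → ≈⇒∼ (+ᴹ-comm x y)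
            }
          ; isPreleftSemimodule = record
            { *ₗ-cong      = λ {k} {l} {x} {y} k≈l x∼y →
                ∈-resp (≈ᴹ-trans (*ₗ-distribˡ k x (-ᴹ y))
                         (+ᴹ-congˡ (≈ᴹ-trans (*ₗ-neg k y) (-ᴹ‿cong (*ₗ-congʳ k≈l)))))
                  (*ₗ∈ k x∼y)
            ; *ₗ-zeroˡ     = λ x → ≈⇒∼ (*ₗ-zeroˡ x)
            ; *ₗ-distribʳ  = λ x k l → ≈⇒∼ (*ₗ-distribʳ x k l)
            ; *ₗ-identityˡ = λ x → ≈⇒∼ (*ₗ-identityˡ x)
            ; *ₗ-assoc     = λ k l x → ≈⇒∼ (*ₗ-assoc k l x)
            ; *ₗ-zeroʳ     = λ k → ≈⇒∼ (*ₗ-zeroʳ k)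
            ; *ₗ-distribˡ  = λ k x y → ≈⇒∼ (*ₗ-distribˡ k x y)
            }
          }
        ; -ᴹ‿cong    = λ {x} {y} x∼y → ∈-resp (-[x-y] x y) (-∈ x∼y)
        ; -ᴹ‿inverse = (λ x → ≈⇒∼ (-ᴹ‿inverseˡ x)) , (λ x → ≈⇒∼ (-ᴹ‿inverseʳ x))
        }
      }
    }
    where
    open IsSubmodule isSubmodule
    open SetoidReasoning ≈ᴹ-setoid
    open ModuleProperties M using (inverseʳ-uniqueᴹ; -ᴹ-involutive)
    open AbelianGroupProperties +ᴹ-abelianGroup using (⁻¹-∙-comm)
    open CommutativeSemigroupProperties
      (CommutativeMonoid.commutativeSemigroup +ᴹ-commutativeMonoid)
      using (interchange)

    _∼_ : Rel Carrierᴹ p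
    x ∼ y = x +ᴹ -ᴹ y ∈ N

    ≈⇒∼ : ∀ {x y} → x ≈ᴹ y → x ∼ y
    ≈⇒∼ {x} {y} x≈y =
      ∈-resp (≈ᴹ-sym (≈ᴹ-trans (+ᴹ-congʳ x≈y) (-ᴹ‿inverseʳ y))) 0∈

    *ₗ-neg : ∀ k x → k *ₗ (-ᴹ x) ≈ᴹ -ᴹ (k *ₗ x)
    *ₗ-neg k x = inverseʳ-uniqueᴹ (k *ₗ x) (k *ₗ (-ᴹ x)) (begin
      k *ₗ x +ᴹ k *ₗ (-ᴹ x) ≈⟨ *ₗ-distribˡ k x (-ᴹ x) ⟨
      k *ₗ (x +ᴹ -ᴹ x)      ≈⟨ *ₗ-congˡ (-ᴹ‿inverseʳ x) ⟩
      k *ₗ 0ᴹ               ≈⟨ *ₗ-zeroʳ k ⟩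
      0ᴹ                    ∎)

    -1*ₗ : ∀ x → (- 1#) *ₗ x ≈ᴹ -ᴹ x
    -1*ₗ x = inverseʳ-uniqueᴹ x ((- 1#) *ₗ x) (begin
      x +ᴹ (- 1#) *ₗ x          ≈⟨ +ᴹ-congʳ (*ₗ-identityˡ x) ⟨
      1# *ₗ x +ᴹ (- 1#) *ₗ x    ≈⟨ *ₗ-distribʳ x 1# (- 1#) ⟨
      (1# R.+ - 1#) *ₗ x        ≈⟨ *ₗ-congʳ (-‿inverseʳ 1#) ⟩
      0# *ₗ x                   ≈⟨ *ₗ-zeroˡ x ⟩
      0ᴹ                        ∎)
      where module R = CommutativeRing R

    -∈ : ∀ {x} → x ∈ N → -ᴹ x ∈ N
    -∈ {x} x∈N = ∈-resp (-1*ₗ x) (*ₗ∈ (- 1#) x∈N)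

    -[x-y] : ∀ x y → -ᴹ (x +ᴹ -ᴹ y) ≈ᴹ -ᴹ x +ᴹ -ᴹ (-ᴹ y)
    -[x-y] x y = ≈ᴹ-sym (⁻¹-∙-comm x (-ᴹ y))

    telescope : ∀ x y z → (x +ᴹ -ᴹ y) +ᴹ (y +ᴹ -ᴹ z) ≈ᴹ x +ᴹ -ᴹ z
    telescope x y z = begin
      (x +ᴹ -ᴹ y) +ᴹ (y +ᴹ -ᴹ z) ≈⟨ +ᴹ-assoc x (-ᴹ y) (y +ᴹ -ᴹ z) ⟩
      x +ᴹ (-ᴹ y +ᴹ (y +ᴹ -ᴹ z)) ≈⟨ +ᴹ-congˡ (+ᴹ-assoc (-ᴹ y) y (-ᴹ z)) ⟨
      x +ᴹ ((-ᴹ y +ᴹ y) +ᴹ -ᴹ z) ≈⟨ +ᴹ-congˡ (+ᴹ-congʳ (-ᴹ‿inverseˡ y)) ⟩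
      x +ᴹ (0ᴹ +ᴹ -ᴹ z)          ≈⟨ +ᴹ-congˡ (+ᴹ-identityˡ (-ᴹ z)) ⟩
      x +ᴹ -ᴹ z                  ∎

    swap : ∀ x y u v → (x +ᴹ -ᴹ y) +ᴹ (u +ᴹ -ᴹ v) ≈ᴹ (x +ᴹ u) +ᴹ -ᴹ (y +ᴹ v)
    swap x y u v = ≈ᴹ-trans (interchange x (-ᴹ y) u (-ᴹ v)) (+ᴹ-congˡ (⁻¹-∙-comm y v))

-- The free module on X.  A formal sum is a list of terms; two formal sums are
-- equal when every basis element has the same total coefficient in both.
module FreeModule (R : CommutativeRing r ℓr) {X : Set} (_≟_ : DecidableEquality X) where
  open CommutativeRing R
    renaming (Carrier to K; _+_ to _+ᴷ_; _*_ to _*ᴷ_; refl to ≈-refl; sym to ≈-sym; trans to ≈-trans)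
    hiding (zero)

  FormalSum : Set r
  FormalSum = List (K × X)

  basis : X → FormalSum
  basis x = [ 1# , x ]

  -- The linear extension of φ.
  extend : (X → K) → FormalSum → K
  extend φ []            = 0#
  extend φ ((k , x) ∷ f) = k *ᴷ φ x +ᴷ extend φ f

  coefficient : X → FormalSum → K
  coefficient x = extend (λ y → if does (x ≟ y) then 1# else 0#)

  infixr 7 _·_
  _·_ : K → FormalSum → FormalSum
  k · f = map (map₁ (k *ᴷ_)) f

  _≋_ : Rel FormalSum ℓr
  f ≋ g = ∀ x → coefficient x f ≈ coefficient x g

  extend-++ : ∀ φ f g → extend φ (f ++ g) ≈ extend φ f +ᴷ extend φ g
  extend-++ φ []            g = ≈-sym (+-identityˡ _)
  extend-++ φ ((k , x) ∷ f) g =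
    ≈-trans (+-congˡ (extend-++ φ f g)) (≈-sym (+-assoc _ _ _))

  extend-· : ∀ φ k f → extend φ (k · f) ≈ k *ᴷ extend φ f
  extend-· φ k []            = ≈-sym (zeroʳ k)
  extend-· φ k ((l , x) ∷ f) =
    ≈-trans (+-cong (*-assoc k l (φ x)) (extend-· φ k f)) (≈-sym (distribˡ k _ _))

  freeModule : Module R r ℓr
  freeModule = record
    { isModule = IsModuleFromLeft.isModule {commutativeRing = R}
        {≈ᴹ = _≋_} {+ᴹ = _++_} {0ᴹ = []} { -ᴹ = (- 1#) ·_ } {*ₗ = _·_} record
      { isLeftModule = record
        { isLeftSemimodule = record
          { +ᴹ-isCommutativeMonoid = record
            { isMonoid = record
              { isSemigroup = record
                { isMagma = record
                  { isEquivalence = record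
                    { refl  = λ _ → ≈-refl
                    ; sym   = λ f≋g x → ≈-sym (f≋g x)
                    ; trans = λ f≋g g≋h x → ≈-trans (f≋g x) (g≋h x)
                    }
                  ; ∙-cong = λ {f} {f′} {g} {g′} f≋f′ g≋g′ x → begin
                      ⟦ x ⟧ (f ++ g)          ≈⟨ ++-coeff x f g ⟩
                      ⟦ x ⟧ f +ᴷ ⟦ x ⟧ g      ≈⟨ +-cong (f≋f′ x) (g≋g′ x) ⟩
                      ⟦ x ⟧ f′ +ᴷ ⟦ x ⟧ g′    ≈⟨ ++-coeff x f′ g′ ⟨
                      ⟦ x ⟧ (f′ ++ g′)        ∎
                  }
                ; assoc = λ f g h x → begin
                    ⟦ x ⟧ ((f ++ g) ++ h)               ≈⟨ ++-coeff x (f ++ g) h ⟩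
                    ⟦ x ⟧ (f ++ g) +ᴷ ⟦ x ⟧ h           ≈⟨ +-congʳ (++-coeff x f g) ⟩
                    (⟦ x ⟧ f +ᴷ ⟦ x ⟧ g) +ᴷ ⟦ x ⟧ h     ≈⟨ +-assoc _ _ _ ⟩
                    ⟦ x ⟧ f +ᴷ (⟦ x ⟧ g +ᴷ ⟦ x ⟧ h)     ≈⟨ +-congˡ (++-coeff x g h) ⟨
                    ⟦ x ⟧ f +ᴷ ⟦ x ⟧ (g ++ h)           ≈⟨ ++-coeff x f (g ++ h) ⟨
                    ⟦ x ⟧ (f ++ (g ++ h))               ∎
                }
              ; identity = (λ f x → ≈-refl)
                         , (λ f x → ≈-trans (++-coeff x f []) (+-identityʳ _))
              }
            ; comm = λ f g x → begin
                ⟦ x ⟧ (f ++ g)      ≈⟨ ++-coeff x f g ⟩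
                ⟦ x ⟧ f +ᴷ ⟦ x ⟧ g  ≈⟨ +-comm _ _ ⟩
                ⟦ x ⟧ g +ᴷ ⟦ x ⟧ f  ≈⟨ ++-coeff x g f ⟨
                ⟦ x ⟧ (g ++ f)      ∎
            }
          ; isPreleftSemimodule = record
            { *ₗ-cong      = λ {k} {l} {f} {g} k≈l f≋g x → begin
                ⟦ x ⟧ (k · f)   ≈⟨ ·-coeff x k f ⟩
                k *ᴷ ⟦ x ⟧ f    ≈⟨ *-cong k≈l (f≋g x) ⟩
                l *ᴷ ⟦ x ⟧ g    ≈⟨ ·-coeff x l g ⟨
                ⟦ x ⟧ (l · g)   ∎
            ; *ₗ-zeroˡ     = λ f x → ≈-trans (·-coeff x 0# f) (zeroˡ _)
            ; *ₗ-distribʳ  = λ f k l x → begin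
                ⟦ x ⟧ ((k +ᴷ l) · f)               ≈⟨ ·-coeff x (k +ᴷ l) f ⟩
                (k +ᴷ l) *ᴷ ⟦ x ⟧ f                ≈⟨ distribʳ _ k l ⟩
                k *ᴷ ⟦ x ⟧ f +ᴷ l *ᴷ ⟦ x ⟧ f       ≈⟨ +-cong (·-coeff x k f) (·-coeff x l f) ⟨
                ⟦ x ⟧ (k · f) +ᴷ ⟦ x ⟧ (l · f)     ≈⟨ ++-coeff x (k · f) (l · f) ⟨
                ⟦ x ⟧ (k · f ++ l · f)             ∎
            ; *ₗ-identityˡ = λ f x → ≈-trans (·-coeff x 1# f) (*-identityˡ _)
            ; *ₗ-assoc     = λ k l f x → begin
                ⟦ x ⟧ ((k *ᴷ l) · f)    ≈⟨ ·-coeff x (k *ᴷ l) f ⟩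
                (k *ᴷ l) *ᴷ ⟦ x ⟧ f     ≈⟨ *-assoc k l _ ⟩
                k *ᴷ (l *ᴷ ⟦ x ⟧ f)     ≈⟨ *-congˡ (·-coeff x l f) ⟨
                k *ᴷ ⟦ x ⟧ (l · f)      ≈⟨ ·-coeff x k (l · f) ⟨
                ⟦ x ⟧ (k · (l · f))     ∎
            ; *ₗ-zeroʳ     = λ k x → ≈-refl
            ; *ₗ-distribˡ  = λ k f g x → begin
                ⟦ x ⟧ (k · (f ++ g))               ≈⟨ ·-coeff x k (f ++ g) ⟩
                k *ᴷ ⟦ x ⟧ (f ++ g)                ≈⟨ *-congˡ (++-coeff x f g) ⟩
                k *ᴷ (⟦ x ⟧ f +ᴷ ⟦ x ⟧ g)          ≈⟨ distribˡ k _ _ ⟩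
                k *ᴷ ⟦ x ⟧ f +ᴷ k *ᴷ ⟦ x ⟧ g       ≈⟨ +-cong (·-coeff x k f) (·-coeff x k g) ⟨
                ⟦ x ⟧ (k · f) +ᴷ ⟦ x ⟧ (k · g)     ≈⟨ ++-coeff x (k · f) (k · g) ⟨
                ⟦ x ⟧ (k · f ++ k · g)             ∎
            }
          }
        ; -ᴹ‿cong    = λ {f} {g} f≋g x → begin
            ⟦ x ⟧ ((- 1#) · f)   ≈⟨ neg-coeff x f ⟩
            - ⟦ x ⟧ f            ≈⟨ -‿cong (f≋g x) ⟩
            - ⟦ x ⟧ g            ≈⟨ neg-coeff x g ⟨
            ⟦ x ⟧ ((- 1#) · g)   ∎
        ; -ᴹ‿inverse =
            (λ f x → begin
              ⟦ x ⟧ ((- 1#) · f ++ f)         ≈⟨ ++-coeff x ((- 1#) · f) f ⟩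
              ⟦ x ⟧ ((- 1#) · f) +ᴷ ⟦ x ⟧ f   ≈⟨ +-congʳ (neg-coeff x f) ⟩
              - ⟦ x ⟧ f +ᴷ ⟦ x ⟧ f            ≈⟨ -‿inverseˡ _ ⟩
              0#                              ∎)
          , (λ f x → begin
              ⟦ x ⟧ (f ++ (- 1#) · f)         ≈⟨ ++-coeff x f ((- 1#) · f) ⟩
              ⟦ x ⟧ f +ᴷ ⟦ x ⟧ ((- 1#) · f)   ≈⟨ +-congˡ (neg-coeff x f) ⟩
              ⟦ x ⟧ f +ᴷ - ⟦ x ⟧ f            ≈⟨ -‿inverseʳ _ ⟩
              0#                              ∎)
        }
      }
    }
    where
    open SetoidReasoning setoid

    ⟦_⟧ : X → FormalSum → K
    ⟦_⟧ = coefficient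

    ++-coeff : ∀ x f g → ⟦ x ⟧ (f ++ g) ≈ ⟦ x ⟧ f +ᴷ ⟦ x ⟧ g
    ++-coeff x = extend-++ _

    ·-coeff : ∀ x k f → ⟦ x ⟧ (k · f) ≈ k *ᴷ ⟦ x ⟧ f
    ·-coeff x = extend-· _

    neg-coeff : ∀ x f → ⟦ x ⟧ ((- 1#) · f) ≈ - ⟦ x ⟧ f
    neg-coeff x f = ≈-trans (·-coeff x (- 1#) f) (RingProperties.-1*x≈-x ring _)

-- A basis of the free nonsymmetric operad on a set A of arity-2 generators is
-- given by the planar binary trees with nodes decorated by A; the arity is the
-- number of leaves, and f ∘ᵢ g grafts g onto the i-th leaf of f.  Positions are
-- elements of Fin, so they start at 0: ∘⟨ 0F ⟩ is ∘₁ and ∘⟨ 1F ⟩ is ∘₂.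

module _ {A : Set} where

  graft : (t : Tree A ⊤) → Fin (#leaves t) → Tree A ⊤ → Tree A ⊤
  graft (leaf _)     _ s = s
  graft (node l a r) i s with splitAt (#leaves l) i
  ... | inj₁ j = node (graft l j s) a r
  ... | inj₂ j = node l a (graft r j s)

  #leaves-graft : ∀ t i s → suc (#leaves (graft t i s)) ≡ #leaves t + #leaves s
  #leaves-graft (leaf _)     _ s = refl
  #leaves-graft (node l a r) i s with splitAt (#leaves l) i
  ... | inj₁ j = begin
    suc (#leaves (graft l j s)) + #leaves r   ≡⟨ cong (_+ #leaves r) (#leaves-graft l j s) ⟩
    #leaves l + #leaves s + #leaves r         ≡⟨ rearrange (#leaves l) (#leaves s) (#leaves r) ⟩
    #leaves l + #leaves r + #leaves s         ∎
    where
    open ≡-Reasoning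
    rearrange : ∀ x y z → x + y + z ≡ x + z + y
    rearrange = solve-∀
  ... | inj₂ j = begin
    suc (#leaves l + #leaves (graft r j s))   ≡⟨ ℕₚ.+-suc (#leaves l) _ ⟨
    #leaves l + suc (#leaves (graft r j s))   ≡⟨ cong (#leaves l +_) (#leaves-graft r j s) ⟩
    #leaves l + (#leaves r + #leaves s)       ≡⟨ ℕₚ.+-assoc (#leaves l) _ _ ⟨
    #leaves l + #leaves r + #leaves s         ∎
    where open ≡-Reasoning

record Monomial (A : Set) (n : ℕ) : Set where
  constructor _,_
  field
    tree   : Tree A ⊤
    .arity : #leaves tree ≡ n

open Monomial

module _ {A : Set} where

  corolla : A → Monomial A 2
  corolla a = node (leaf tt) a (leaf tt) , refl

  infixl 7 _∘ᵐ⟨_⟩_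
  _∘ᵐ⟨_⟩_ : ∀ {m n} → Monomial A m → Fin m → Monomial A n → Monomial A (m + n ∸ 1)
  (t , p) ∘ᵐ⟨ i ⟩ (s , q) =
      graft t (cast (sym p) i) s
    , cong pred (trans (#leaves-graft t (cast (sym p) i) s) (cong₂ _+_ p q))

  module _ (_≟ᴬ_ : DecidableEquality A) where

    ≟-tree : DecidableEquality (Tree A ⊤)
    ≟-tree (leaf _)     (leaf _)     = yes refl
    ≟-tree (leaf _)     (node _ _ _) = no λ ()
    ≟-tree (node _ _ _) (leaf _)     = no λ ()
    ≟-tree (node l a r) (node l′ a′ r′) with ≟-tree l l′ | a ≟ᴬ a′ | ≟-tree r r′
    ... | yes refl | yes refl | yes refl = yes refl
    ... | no l≢    | _        | _        = no λ { refl → l≢ refl }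
    ... | yes _    | no a≢    | _        = no λ { refl → a≢ refl }
    ... | yes _    | yes _    | no r≢    = no λ { refl → r≢ refl }

    ≟-monomial : ∀ {n} → DecidableEquality (Monomial A n)
    ≟-monomial (t , _) (s , _) with ≟-tree t s
    ... | yes refl = yes refl
    ... | no t≢s   = no λ { refl → t≢s refl }

module Quadratic (R : CommutativeRing r ℓr) {A : Set} (_≟_ : DecidableEquality A) where
  open CommutativeRing R
    renaming (Carrier to K; _+_ to _+ᴷ_; _*_ to _*ᴷ_) hiding (zero; refl; sym; trans)
  private module F {n : ℕ} = FreeModule R (≟-monomial _≟_ {n})
  open F

  free : ℕ → Module R r ℓr
  free n = F.freeModule {n}

  Free : ℕ → Set r
  Free n = Module.Carrierᴹ (free n)

  E : A → Free 2
  E a = basis (corolla a)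

  infixl 7 _∘⟨_⟩_
  _∘⟨_⟩_ : ∀ {m n} → Free m → Fin m → Free n → Free (m + n ∸ 1)
  f ∘⟨ i ⟩ g = cartesianProductWith (λ (k , s) (l , t) → k *ᴷ l , s ∘ᵐ⟨ i ⟩ t) f g

  data Ideal (S : Pred (Free 3) p) : ∀ n → Pred (Free n) (r ⊔ ℓr ⊔ p) where
    generator : ∀ {f} → f ∈ S → f ∈ Ideal S 3
    resp      : ∀ {n} {f g : Free n} → f ≋ g → f ∈ Ideal S n → g ∈ Ideal S n
    zeroᴹ     : ∀ {n} → [] ∈ Ideal S n
    plus      : ∀ {n} {f g : Free n} → f ∈ Ideal S n → g ∈ Ideal S n → f ++ g ∈ Ideal S n
    scale     : ∀ {n} k {f : Free n} → f ∈ Ideal S n → k · f ∈ Ideal S n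
    composeˡ  : ∀ {m n} {f : Free m} (i : Fin m) (g : Free n) →
                f ∈ Ideal S m → f ∘⟨ i ⟩ g ∈ Ideal S (m + n ∸ 1)
    composeʳ  : ∀ {m n} (f : Free m) (i : Fin m) {g : Free n} →
                g ∈ Ideal S n → f ∘⟨ i ⟩ g ∈ Ideal S (m + n ∸ 1)

  -- The arity-n component of the quotient of the free operad by the ideal generated by S.
  quadraticOperad : Pred (Free 3) p → ℕ → Module R r (r ⊔ ℓr ⊔ p)
  quadraticOperad S n = quotient (free n) {N = Ideal S n} record
    { ∈-resp = resp ; 0∈ = zeroᴹ ; +∈ = plus ; *ₗ∈ = scale }

  -- A tree with three leaves is E x ∘₁ E y if its left child is a node,
  -- and E x ∘₂ E y otherwise.
  sign : Monomial A 3 → K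
  sign (node (node _ _ _) _ _ , _) = 1#
  sign _                           = - 1#

  -- The dual generators E⋆ₐ are also indexed by A, so both arguments of the
  -- pairing are elements of `Free 3`, the first one read in the dual generators.
  ⟨_,_⟩ : Free 3 → Free 3 → K
  ⟨ f , g ⟩ = extend (λ s → extend (pair s) g) f
    where
    pair : Monomial A 3 → Monomial A 3 → K
    pair s t = if does (≟-monomial _≟_ s t) then sign s else 0#

  infix 8 _⊥
  _⊥ : Pred (Free 3) p → Pred (Free 3) (r ⊔ ℓr ⊔ p)
  (S ⊥) f = ∀ g → g ∈ S → ⟨ f , g ⟩ ≈ 0#

  koszulDual : Pred (Free 3) p → ℕ → Module R r (r ⊔ ℓr ⊔ p)
  koszulDual S = quadraticOperad (S ⊥)

module Hi (R : CommutativeRing r ℓr) (c : ℕ) where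
  open Quadratic R (Fin._≟_ {suc c}) public

  private
    infixl 6 _-ᶠ_
    _-ᶠ_ : Free 3 → Free 3 → Free 3
    f -ᶠ g = f +ᴹ -ᴹ g
      where open Module (free 3)

  data Relator : Pred (Free 3) r where
    absorb : ∀ {a a′ b} → a Fin.≤ b → a′ Fin.≤ b →
             Relator (E a ∘⟨ 0F ⟩ E b -ᶠ E b ∘⟨ 1F ⟩ E a′)
    switch : ∀ {a b} → a Fin.< b →
             Relator (E b ∘⟨ 0F ⟩ E a -ᶠ E a ∘⟨ 1F ⟩ E b)

  Relations : Pred (Free 3) (r ⊔ ℓr)
  Relations = Span (free 3) Relator

module _ {k ℓ₁ ℓ₂} (K : HeytingField k ℓ₁ ℓ₂) where

  fieldRing : CommutativeRing k ℓ₁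
  fieldRing = HeytingCommutativeRing.commutativeRing (HeytingField.heytingCommutativeRing K)

  CharacteristicZero : Set ℓ₁
  CharacteristicZero = ∀ n → ¬ (suc n ×ᴷ 1# ≈ 0#)
    where
    open CommutativeRing fieldRing
    open Mult +-monoid renaming (_×_ to _×ᴷ_)

  -- The arity-n component of Hi_c^!.
  Hi! : ℕ → ℕ → Module fieldRing k (k ⊔ ℓ₁)
  Hi! c = koszulDual Relations
    where open Hi fieldRing c

module Submission where

open import Defs
open import Algebra.Apartness.Bundles using (HeytingField)
open import Algebra.Bundles using (CommutativeMonoid; CommutativeRing)
open import Algebra.Module.Bundles using (Module)
import Algebra.Properties.CommutativeMonoid.Sum as Sum
import Algebra.Properties.CommutativeSemigroup as CommutativeSemigroupProperties
import Algebra.Properties.Ring as RingProperties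
open import Data.Bool.Base using (if_then_else_)
open import Data.Fin.Base as Fin using (Fin; zero; suc; toℕ; splitAt; cast)
open import Data.Fin.Patterns using (0F; 1F; 2F)
import Data.Fin.Properties as Fin
open import Data.List.Base using (List; []; _∷_; [_]; _++_; map; length; lookup)
import Data.List.Properties as List
import Data.List.Membership.Propositional as ListMembership
open import Data.List.Membership.Propositional.Properties
  using (∈-map⁺; ∈-map⁻; ∈-++⁺ˡ; ∈-++⁺ʳ; ∈-lookup)
open import Data.List.Relation.Unary.All as All using (All; []; _∷_)
import Data.List.Relation.Unary.All.Properties as AllP
open import Data.List.Relation.Unary.AllPairs using ([]; _∷_)
open import Data.List.Relation.Unary.Any as Any using (here)
import Data.List.Relation.Unary.Any.Properties as AnyP
open import Data.List.Relation.Unary.Unique.Propositional using (Unique)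
import Data.List.Relation.Unary.Unique.Propositional.Properties as Unique
open import Data.Maybe.Base using (Maybe; just; nothing)
open import Data.Maybe.Properties using (just-injective)
open import Data.Maybe.Relation.Unary.All as Allᵐ using (just; nothing)
open import Data.Nat.Base as ℕ using (ℕ; zero; suc; _≤_; _<_; _≥_; z≤n; s≤s)
open import Data.Nat.Combinatorics using (_C_; nCk+nC[k+1]≡[n+1]C[k+1]; nC1≡n)
import Data.Nat.Properties as ℕₚ
open import Data.Nat.Tactic.RingSolver using (solve-∀)
open import Data.Product.Base using (_×_; _,_; ∃; map₁; map₂; proj₁; proj₂)
open import Data.Sum.Base using (inj₁; inj₂)
open import Data.Tree.Binary using (Tree; leaf; node; #leaves)
open import Data.Unit.Base using (⊤; tt)
open import Data.Vec.Base as Vec using (Vec; []; _∷_; take; drop)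
import Data.Vec.Properties as Vec
open import Data.Vec.Relation.Unary.All as Allᵛ using ([]; _∷_)
import Data.Vec.Relation.Unary.All.Properties as AllᵛP
open import Function.Base using (_∘_)
open import Level using (Level; _⊔_)
open import Relation.Binary.Definitions using (DecidableEquality)
open import Relation.Binary.PropositionalEquality.Core as ≡ using (_≡_; _≢_)
open import Relation.Binary.PropositionalEquality.Properties using (module ≡-Reasoning)
import Relation.Binary.Reasoning.Setoid as SetoidReasoning
open import Relation.Nullary.Decidable using (does; yes; no; recompute)
open import Relation.Nullary.Negation using (contradiction)
open import Relation.Unary as Unary using (Pred)

-- Put S_k for the sum of the first k dual generators.  The relations of the Koszul
-- dual say precisely that (u a v) S_k w = u a (v S_k w) whenever a < k.  Orienting
-- them leaves as normal forms the trees in which the label of every left child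
-- exceeds that of its parent.  They span because u S_k w can be rewritten along the
-- right spine of u.  They are independent because the same recipe defines operations
-- on the free module on all trees which satisfy the relations and send a normal tree,
-- evaluated on leaves, to itself.  The left spine of a normal tree carries one optional
-- normal tree for each of the c + 1 labels, so normal trees with n leaves are
-- (c + 1)-ary trees with n nodes.

-- Write E⋆ for the dual generators and fix b. Orthogonality to `absorb` forces one common
-- coefficient on all E⋆_a ∘₁ E⋆_b with a ≤ b, and its opposite on all E⋆_b ∘₂ E⋆_a with a ≤ b;
-- orthogonality to `switch` makes the coefficients of E⋆_a ∘₁ E⋆_b and E⋆_b ∘₂ E⋆_a opposite for
-- each single a > b. So the labels a ≤ b enter only through their sum, which gives the relation for
-- S_k at k = b + 1, and adding the labels above b one at a time gives every larger k. This is why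
-- partial sums are the primary operations and a single label is recovered as S_(a+1) - S_a. No
-- confluence argument is made. In the model all the relations come from one identity, (u S_j v) S_k
-- w = u S_j (v S_k w) for j ≤ k, by taking differences in j and in k. The model acts on all trees,
-- so normality never has to be preserved by its operations. Formal sums are handled through their
-- totals against arbitrary functions φ, since lists representing the same element can differ in
-- order and repetition.

private
  variable
    r ℓr : Level
    N : ℕ

open Monomial using (tree)

-- Formal sums

module Integral (R : CommutativeRing r ℓr) where
  open CommutativeRing R
  open SetoidReasoning setoid
  open CommutativeSemigroupProperties
    (CommutativeMonoid.commutativeSemigroup +-commutativeMonoid) using (interchange)
    renaming (x∙yz≈y∙xz to x+[y+z]≈y+[x+z])
  open CommutativeSemigroupProperties
    (CommutativeMonoid.commutativeSemigroup *-commutativeMonoid) using (x∙yz≈y∙xz)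
  open RingProperties ring using (-1*x≈-x; x∙y⁻¹≈ε⇒x≈y)

  private
    variable
      X Y : Set
      φ ψ : X → Carrier

  Sums : Set → Set r
  Sums X = List (Carrier × X)

  -- The total of φ over the terms of f, written as an integral because most of
  -- the work consists of exchanging and composing such totals.
  ∫ : Sums X → (X → Carrier) → Carrier
  ∫ []            φ = 0#
  ∫ ((k , x) ∷ f) φ = k * φ x + ∫ f φ

  pure : X → Sums X
  pure x = [ 1# , x ]

  infixr 7 _•_
  _•_ : Carrier → Sums X → Sums X
  k • f = map (map₁ (k *_)) f

  infixl 6 _⊖_
  _⊖_ : Sums X → Sums X → Sums X
  f ⊖ g = f ++ (- 1#) • g

  infixl 5 _>>=_
  _>>=_ : Sums X → (X → Sums Y) → Sums Y
  []            >>= h = []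
  ((k , x) ∷ f) >>= h = k • h x ++ (f >>= h)

  ∫-cong : ∀ (f : Sums X) → (∀ x → φ x ≈ ψ x) → ∫ f φ ≈ ∫ f ψ
  ∫-cong []            φ≈ψ = refl
  ∫-cong ((k , x) ∷ f) φ≈ψ = +-cong (*-congˡ (φ≈ψ x)) (∫-cong f φ≈ψ)

  ∫-pure : ∀ (x : X) φ → ∫ (pure x) φ ≈ φ x
  ∫-pure x φ = trans (+-identityʳ _) (*-identityˡ _)

  ∫-++ : ∀ (f g : Sums X) φ → ∫ (f ++ g) φ ≈ ∫ f φ + ∫ g φ
  ∫-++ []            g φ = sym (+-identityˡ _)
  ∫-++ ((k , x) ∷ f) g φ = trans (+-congˡ (∫-++ f g φ)) (sym (+-assoc _ _ _))

  ∫-• : ∀ k (f : Sums X) φ → ∫ (k • f) φ ≈ k * ∫ f φ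
  ∫-• k []            φ = sym (zeroʳ k)
  ∫-• k ((l , x) ∷ f) φ =
    trans (+-cong (*-assoc k l (φ x)) (∫-• k f φ)) (sym (distribˡ k _ _))

  ∫-⊖ : ∀ (f g : Sums X) φ → ∫ (f ⊖ g) φ ≈ ∫ f φ - ∫ g φ
  ∫-⊖ f g φ = trans (∫-++ f _ φ) (+-congˡ (trans (∫-• _ g φ) (-1*x≈-x _)))

  ∫-map : ∀ (θ : X → Y) (f : Sums X) φ → ∫ (map (map₂ θ) f) φ ≈ ∫ f (φ ∘ θ)
  ∫-map θ []            φ = refl
  ∫-map θ ((k , x) ∷ f) φ = +-congˡ (∫-map θ f φ)

  ∫->>= : ∀ (f : Sums X) (h : X → Sums Y) φ → ∫ (f >>= h) φ ≈ ∫ f (λ x → ∫ (h x) φ)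
  ∫->>= []            h φ = refl
  ∫->>= ((k , x) ∷ f) h φ =
    trans (∫-++ (k • h x) _ φ) (+-cong (∫-• k (h x) φ) (∫->>= f h φ))

  ∫-zero : ∀ (f : Sums X) → (∀ x → φ x ≈ 0#) → ∫ f φ ≈ 0#
  ∫-zero []            φ≈0 = refl
  ∫-zero ((k , x) ∷ f) φ≈0 =
    trans (+-cong (trans (*-congˡ (φ≈0 x)) (zeroʳ k)) (∫-zero f φ≈0)) (+-identityˡ _)

  ∫-+ : ∀ (f : Sums X) φ ψ → ∫ f (λ x → φ x + ψ x) ≈ ∫ f φ + ∫ f ψ
  ∫-+ []            φ ψ = sym (+-identityˡ _)
  ∫-+ ((k , x) ∷ f) φ ψ =
    trans (+-cong (distribˡ k _ _) (∫-+ f φ ψ)) (interchange _ _ _ _)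

  ∫-* : ∀ l (f : Sums X) φ → ∫ f (λ x → l * φ x) ≈ l * ∫ f φ
  ∫-* l []            φ = sym (zeroʳ l)
  ∫-* l ((k , x) ∷ f) φ =
    trans (+-cong (x∙yz≈y∙xz k l _) (∫-* l f φ)) (sym (distribˡ l _ _))

  ∫-- : ∀ (f : Sums X) φ ψ → ∫ f (λ x → φ x - ψ x) ≈ ∫ f φ - ∫ f ψ
  ∫-- f φ ψ = begin
    ∫ f (λ x → φ x - ψ x)                ≈⟨ ∫-+ f φ (λ x → - ψ x) ⟩
    ∫ f φ + ∫ f (λ x → - ψ x)            ≈⟨ +-congˡ (∫-cong f λ x → -1*x≈-x (ψ x)) ⟨
    ∫ f φ + ∫ f (λ x → (- 1#) * ψ x)     ≈⟨ +-congˡ (trans (∫-* _ f ψ) (-1*x≈-x _)) ⟩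
    ∫ f φ - ∫ f ψ                        ∎

  ∫-swap : ∀ (f : Sums X) (g : Sums Y) (Φ : X → Y → Carrier) →
           ∫ f (λ x → ∫ g (Φ x)) ≈ ∫ g (λ y → ∫ f (λ x → Φ x y))
  ∫-swap []            g Φ = sym (∫-zero g λ _ → refl)
  ∫-swap ((k , x) ∷ f) g Φ = begin
    k * ∫ g (Φ x) + ∫ f (λ x → ∫ g (Φ x))                     ≈⟨ +-cong (sym (∫-* k g (Φ x))) (∫-swap f g Φ) ⟩
    ∫ g (λ y → k * Φ x y) + ∫ g (λ y → ∫ f (λ x → Φ x y))     ≈⟨ ∫-+ g _ _ ⟨
    ∫ g (λ y → k * Φ x y + ∫ f (λ x → Φ x y))                 ∎

  module _ (_≟_ : DecidableEquality X) where
    open FreeModule R _≟_ using (extend; _≋_)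

    indicator : X → X → Carrier
    indicator x y = if does (x ≟ y) then 1# else 0#

    indicator-diag : ∀ x → indicator x x ≈ 1#
    indicator-diag x with x ≟ x
    ... | yes _  = refl
    ... | no x≢x = contradiction ≡.refl x≢x

    indicator-off : ∀ {x y} → x ≢ y → indicator x y ≈ 0#
    indicator-off {x} {y} x≢y with x ≟ y
    ... | yes x≡y = contradiction x≡y x≢y
    ... | no  _   = refl

    extend≈∫ : ∀ φ f → extend φ f ≈ ∫ f φ
    extend≈∫ φ []            = refl
    extend≈∫ φ ((k , x) ∷ f) = +-congˡ (extend≈∫ φ f)

    remove : X → Sums X → Sums X
    remove x []            = []
    remove x ((k , y) ∷ f) = if does (x ≟ y) then remove x f else (k , y) ∷ remove x f

    length-remove : ∀ x f → length (remove x f) ≤ length f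
    length-remove x []            = z≤n
    length-remove x ((k , y) ∷ f) with x ≟ y
    ... | yes _ = ℕₚ.m≤n⇒m≤1+n (length-remove x f)
    ... | no  _ = s≤s (length-remove x f)

    ∫-remove : ∀ x f φ → ∫ f φ ≈ ∫ f (indicator x) * φ x + ∫ (remove x f) φ
    ∫-remove x []            φ = sym (trans (+-identityʳ _) (zeroˡ _))
    ∫-remove x ((k , y) ∷ f) φ with x ≟ y
    ... | yes ≡.refl = begin
      k * φ x + ∫ f φ                                                 ≈⟨ +-cong (*-congʳ (sym (*-identityʳ k))) (∫-remove x f φ) ⟩
      k * 1# * φ x + (∫ f (indicator x) * φ x + ∫ (remove x f) φ)     ≈⟨ +-assoc _ _ _ ⟨
      k * 1# * φ x + ∫ f (indicator x) * φ x + ∫ (remove x f) φ       ≈⟨ +-congʳ (distribʳ (φ x) _ _) ⟨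
      (k * 1# + ∫ f (indicator x)) * φ x + ∫ (remove x f) φ           ∎
    ... | no _ = begin
      k * φ y + ∫ f φ                                                 ≈⟨ +-congˡ (∫-remove x f φ) ⟩
      k * φ y + (∫ f (indicator x) * φ x + ∫ (remove x f) φ)          ≈⟨ x+[y+z]≈y+[x+z] _ _ _ ⟩
      ∫ f (indicator x) * φ x + (k * φ y + ∫ (remove x f) φ)          ≈⟨ +-congʳ (*-congʳ (trans (+-congʳ (zeroʳ k)) (+-identityˡ _))) ⟨
      (k * 0# + ∫ f (indicator x)) * φ x + (k * φ y + ∫ (remove x f) φ) ∎

    -- Removing every term of the leading basis element changes no total, because its coefficient is
    -- zero, and shortens the list. The bound `n` makes this a structural recursion.
    ∫-null : ∀ n f → length f ≤ n → (∀ x → ∫ f (indicator x) ≈ 0#) → ∀ φ → ∫ f φ ≈ 0#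
    ∫-null n       []              _       null φ = refl
    ∫-null (suc n) ((k , x) ∷ f) (s≤s le) null φ = begin
      ∫ ((k , x) ∷ f) φ                                 ≈⟨ split φ ⟩
      ∫ (remove x ((k , x) ∷ f)) φ                      ≈⟨ ∫-null n (remove x ((k , x) ∷ f)) shorter (λ y → trans (sym (split (indicator y))) (null y)) φ ⟩
      0#                                                ∎
      where
      split : ∀ ψ → ∫ ((k , x) ∷ f) ψ ≈ ∫ (remove x ((k , x) ∷ f)) ψ
      split ψ = trans (∫-remove x ((k , x) ∷ f) ψ)
        (trans (+-congʳ (trans (*-congʳ (null x)) (zeroˡ _))) (+-identityˡ _))

      shorter : length (remove x ((k , x) ∷ f)) ≤ n
      shorter with x ≟ x
      ... | yes _  = ℕₚ.≤-trans (length-remove x f) le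
      ... | no x≢x = contradiction ≡.refl x≢x

    -- Together with `∫⇒≋` this turns equality of formal sums into equality of totals against every
    -- `φ`. The converse only needs the indicators; here all functions must be reached from them.
    ∫-resp-≋ : ∀ {f g} → f ≋ g → ∀ φ → ∫ f φ ≈ ∫ g φ
    ∫-resp-≋ {f} {g} f≋g φ = x∙y⁻¹≈ε⇒x≈y _ _ (trans (sym (∫-⊖ f g φ))
      (∫-null _ (f ⊖ g) ℕₚ.≤-refl (λ x → begin
        ∫ (f ⊖ g) (indicator x)                 ≈⟨ ∫-⊖ f g _ ⟩
        ∫ f (indicator x) - ∫ g (indicator x)   ≈⟨ +-congʳ (trans (sym (extend≈∫ _ f)) (trans (f≋g x) (extend≈∫ _ g))) ⟩
        ∫ g (indicator x) - ∫ g (indicator x)   ≈⟨ -‿inverseʳ _ ⟩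
        0#                                      ∎) φ))

    ∫⇒≋ : ∀ {f g} → (∀ φ → ∫ f φ ≈ ∫ g φ) → f ≋ g
    ∫⇒≋ {f} {g} f≈g x = trans (extend≈∫ _ f) (trans (f≈g _) (sym (extend≈∫ _ g)))

-- A model of the Koszul dual on trees

BTree : ℕ → Set
BTree N = Tree (Fin N) ⊤

-- A leaf behaves like a root of infinite label, so a leaf as left child never violates normality.
_≤root_ : ℕ → BTree N → Set
k ≤root leaf _     = ⊤
k ≤root node _ y _ = k ≤ toℕ y

≤root-weaken : ∀ {j k} → j ≤ k → ∀ (u : BTree N) → k ≤root u → j ≤root u
≤root-weaken j≤k (leaf _)     _   = tt
≤root-weaken j≤k (node _ _ _) k≤y = ℕₚ.≤-trans j≤k k≤y

Normal : BTree N → Set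
Normal (leaf _)     = ⊤
Normal (node l a r) = suc (toℕ a) ≤root l × Normal l × Normal r

module Model (R : CommutativeRing r ℓr) where
  open CommutativeRing R hiding (zero)
  open SetoidReasoning setoid
  open RingProperties ring using (-0#≈0#; //-rightDividesʳ)
  open Integral R

  -- The list saturates at `N`, so statements that need exactly `k` terms, such as
  -- `∫-labels-telescope`, assume `k ≤ N`.
  labels : ℕ → Sums (Fin N)
  labels zero            = []
  labels {zero}  (suc k) = []
  labels {suc N} (suc k) = (1# , zero) ∷ map (map₂ suc) (labels k)

  ∫-labels-∷ : ∀ k (φ : Fin (suc N) → Carrier) →
               ∫ (labels (suc k)) φ ≈ φ zero + ∫ (labels k) (φ ∘ suc)
  ∫-labels-∷ k φ = +-cong (*-identityˡ _) (∫-map suc (labels k) φ)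

  ∫-labels-suc : ∀ (a : Fin N) φ →
                 ∫ (labels (suc (toℕ a))) φ ≈ ∫ (labels (toℕ a)) φ + φ a
  ∫-labels-suc zero    φ = trans (∫-labels-∷ 0 φ) (+-comm _ _)
  ∫-labels-suc (suc a) φ = begin
    ∫ (labels (suc (suc (toℕ a)))) φ                      ≈⟨ ∫-labels-∷ (suc (toℕ a)) φ ⟩
    φ zero + ∫ (labels (suc (toℕ a))) (φ ∘ suc)           ≈⟨ +-congˡ (∫-labels-suc a (φ ∘ suc)) ⟩
    φ zero + (∫ (labels (toℕ a)) (φ ∘ suc) + φ (suc a))   ≈⟨ +-assoc _ _ _ ⟨
    φ zero + ∫ (labels (toℕ a)) (φ ∘ suc) + φ (suc a)     ≈⟨ +-congʳ (∫-labels-∷ (toℕ a) φ) ⟨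
    ∫ (labels (suc (toℕ a))) φ + φ (suc a)                ∎

  ∫-labels-cong : ∀ k {φ ψ : Fin N → Carrier} → (∀ a → toℕ a < k → φ a ≈ ψ a) →
                  ∫ (labels k) φ ≈ ∫ (labels k) ψ
  ∫-labels-cong         zero    φ≈ψ = refl
  ∫-labels-cong {zero}  (suc k) φ≈ψ = refl
  ∫-labels-cong {suc N} (suc k) {φ} {ψ} φ≈ψ = begin
    ∫ (labels (suc k)) φ                ≈⟨ ∫-labels-∷ k φ ⟩
    φ zero + ∫ (labels k) (φ ∘ suc)     ≈⟨ +-cong (φ≈ψ zero (s≤s z≤n)) (∫-labels-cong k λ a a<k → φ≈ψ (suc a) (s≤s a<k)) ⟩
    ψ zero + ∫ (labels k) (ψ ∘ suc)     ≈⟨ ∫-labels-∷ k ψ ⟨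
    ∫ (labels (suc k)) ψ                ∎

  ∫-labels-single : ∀ {k} (x : Fin N) → toℕ x < k → ∀ φ → (∀ a → a ≢ x → φ a ≈ 0#) →
                    ∫ (labels k) φ ≈ φ x
  ∫-labels-single {suc N} {suc k} zero    _         φ φ≈0 = trans (∫-labels-∷ k φ)
    (trans (+-congˡ (∫-zero (labels k) λ a → φ≈0 (suc a) λ ())) (+-identityʳ _))
  ∫-labels-single {suc N} {suc k} (suc x) (s≤s x<k) φ φ≈0 = trans (∫-labels-∷ k φ)
    (trans (+-cong (φ≈0 zero λ ())
                   (∫-labels-single x x<k (φ ∘ suc) λ a a≢x → φ≈0 (suc a) (a≢x ∘ Fin.suc-injective)))
           (+-identityˡ _))

  -- Opaque, so that the full list of labels does not unfold when their number
  -- is a successor.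
  opaque
    allLabels : Sums (Fin N)
    allLabels {N} = labels N

    ∫-allLabels : ∀ (φ : Fin N → Carrier) → ∫ allLabels φ ≈ ∫ (labels N) φ
    ∫-allLabels φ = refl

  ∫-allLabels-single : ∀ (x : Fin N) φ → (∀ a → a ≢ x → φ a ≈ 0#) → ∫ allLabels φ ≈ φ x
  ∫-allLabels-single x φ φ≈0 = trans (∫-allLabels φ) (∫-labels-single x (Fin.toℕ<n x) φ φ≈0)

  sub-telescope : ∀ x y z → (y - x) + (z - y) ≈ z - x
  sub-telescope x y z = begin
    (y - x) + (z - y)     ≈⟨ +-comm _ _ ⟩
    (z - y) + (y - x)     ≈⟨ +-assoc _ _ _ ⟨
    z - y + y - x         ≈⟨ +-congʳ (trans (+-assoc z (- y) y) (trans (+-congˡ (-‿inverseˡ y)) (+-identityʳ z))) ⟩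
    z - x                 ∎

  ∫-labels-telescope : ∀ k (Ψ : ℕ → Carrier) → k ≤ N →
    ∫ (labels {N} k) (λ a → Ψ (suc (toℕ a)) - Ψ (toℕ a)) ≈ Ψ k - Ψ 0
  ∫-labels-telescope zero Ψ _ = sym (-‿inverseʳ _)
  ∫-labels-telescope {suc N} (suc k) Ψ (s≤s k≤N) =
    trans (∫-labels-∷ k _)
      (trans (+-congˡ (∫-labels-telescope k (Ψ ∘ suc) k≤N)) (sub-telescope _ _ _))

  -- These are u S_k w and u a w, where S_k is the sum of the generators below k.
  infix 8 _⊛⟨_⟩_ _⊙⟨_⟩_

  _⊛⟨_⟩_ : BTree N → ℕ → BTree N → Sums (BTree N)
  leaf x ⊛⟨ k ⟩ w       = map (map₂ λ a → node (leaf x) a w) (labels k)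
  node u₁ y u₂ ⊛⟨ k ⟩ w with toℕ y ℕₚ.<? k
  ... | yes _ = map (map₂ (node u₁ y)) (u₂ ⊛⟨ k ⟩ w)
  -- Every `a` below `k` is now below `y`, so the new root is smaller than its left child and
  -- nothing is left to rewrite there.
  ... | no  _ = map (map₂ λ a → node (node u₁ y u₂) a w) (labels k)

  _⊙⟨_⟩_ : BTree N → Fin N → BTree N → Sums (BTree N)
  u ⊙⟨ a ⟩ w = u ⊛⟨ suc (toℕ a) ⟩ w ⊖ u ⊛⟨ toℕ a ⟩ w

  ∫-⊛-< : ∀ {k} {y : Fin N} → toℕ y < k → ∀ u₁ u₂ w φ →
          ∫ (node u₁ y u₂ ⊛⟨ k ⟩ w) φ ≈ ∫ (u₂ ⊛⟨ k ⟩ w) (φ ∘ node u₁ y)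
  ∫-⊛-< {k = k} {y} y<k u₁ u₂ w φ with toℕ y ℕₚ.<? k
  ... | yes _  = ∫-map _ (u₂ ⊛⟨ k ⟩ w) φ
  ... | no y≮k = contradiction y<k y≮k

  ∫-⊛-root : ∀ k (u : BTree N) → k ≤root u → ∀ w φ →
             ∫ (u ⊛⟨ k ⟩ w) φ ≈ ∫ (labels k) (λ a → φ (node u a w))
  ∫-⊛-root k (leaf _)       _   w φ = ∫-map _ (labels k) φ
  ∫-⊛-root k (node u₁ y u₂) k≤y w φ with toℕ y ℕₚ.<? k
  ... | yes y<k = contradiction y<k (ℕₚ.≤⇒≯ k≤y)
  ... | no  _   = ∫-map _ (labels k) φ

  -- If `u` is not entered, u S_j v is the sum of the trees u a v with a < j; since j ≤ k, the outer
  -- product passes each such root and acts on `v`. Otherwise both sides pass the root of `u`, and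
  -- the claim reduces to its right subtree.
  ⊛-assoc : ∀ {j k} → j ≤ k → ∀ (u v w : BTree N) φ →
            ∫ (u ⊛⟨ j ⟩ v) (λ t → ∫ (t ⊛⟨ k ⟩ w) φ) ≈
            ∫ (v ⊛⟨ k ⟩ w) (λ t → ∫ (u ⊛⟨ j ⟩ t) φ)
  ⊛-assoc {N = N} {j} {k} j≤k u v w φ = go u φ
    where
    at-root : ∀ u → j ≤root u → ∀ φ →
              ∫ (u ⊛⟨ j ⟩ v) (λ t → ∫ (t ⊛⟨ k ⟩ w) φ) ≈
              ∫ (v ⊛⟨ k ⟩ w) (λ t → ∫ (u ⊛⟨ j ⟩ t) φ)
    at-root u j≤u φ = begin
      ∫ (u ⊛⟨ j ⟩ v) (λ t → ∫ (t ⊛⟨ k ⟩ w) φ)                ≈⟨ ∫-⊛-root j u j≤u v _ ⟩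
      ∫ (labels j) (λ a → ∫ (node u a v ⊛⟨ k ⟩ w) φ)         ≈⟨ ∫-labels-cong j (λ a a<j → ∫-⊛-< (ℕₚ.<-≤-trans a<j j≤k) u v w φ) ⟩
      ∫ (labels j) (λ a → ∫ (v ⊛⟨ k ⟩ w) (φ ∘ node u a))     ≈⟨ ∫-swap (labels j) (v ⊛⟨ k ⟩ w) _ ⟩
      ∫ (v ⊛⟨ k ⟩ w) (λ t → ∫ (labels j) (λ a → φ (node u a t))) ≈⟨ ∫-cong (v ⊛⟨ k ⟩ w) (λ t → ∫-⊛-root j u j≤u t φ) ⟨
      ∫ (v ⊛⟨ k ⟩ w) (λ t → ∫ (u ⊛⟨ j ⟩ t) φ)                ∎

    go : ∀ u φ → ∫ (u ⊛⟨ j ⟩ v) (λ t → ∫ (t ⊛⟨ k ⟩ w) φ) ≈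
                 ∫ (v ⊛⟨ k ⟩ w) (λ t → ∫ (u ⊛⟨ j ⟩ t) φ)
    go (leaf x)       φ = at-root (leaf x) tt φ
    go (node u₁ y u₂) φ with ℕₚ.<-≤-connex (toℕ y) j
    ... | inj₂ j≤y = at-root (node u₁ y u₂) j≤y φ
    ... | inj₁ y<j = begin
      ∫ (node u₁ y u₂ ⊛⟨ j ⟩ v) (λ t → ∫ (t ⊛⟨ k ⟩ w) φ)         ≈⟨ ∫-⊛-< y<j u₁ u₂ v _ ⟩
      ∫ (u₂ ⊛⟨ j ⟩ v) (λ t → ∫ (node u₁ y t ⊛⟨ k ⟩ w) φ)         ≈⟨ ∫-cong (u₂ ⊛⟨ j ⟩ v) (λ t → ∫-⊛-< (ℕₚ.<-≤-trans y<j j≤k) u₁ t w φ) ⟩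
      ∫ (u₂ ⊛⟨ j ⟩ v) (λ t → ∫ (t ⊛⟨ k ⟩ w) (φ ∘ node u₁ y))     ≈⟨ go u₂ (φ ∘ node u₁ y) ⟩
      ∫ (v ⊛⟨ k ⟩ w) (λ t → ∫ (u₂ ⊛⟨ j ⟩ t) (φ ∘ node u₁ y))     ≈⟨ ∫-cong (v ⊛⟨ k ⟩ w) (λ t → ∫-⊛-< y<j u₁ u₂ t φ) ⟨
      ∫ (v ⊛⟨ k ⟩ w) (λ t → ∫ (node u₁ y u₂ ⊛⟨ j ⟩ t) φ)         ∎

  ∫-⊙ : ∀ (u : BTree N) a w φ →
        ∫ (u ⊙⟨ a ⟩ w) φ ≈ ∫ (u ⊛⟨ suc (toℕ a) ⟩ w) φ - ∫ (u ⊛⟨ toℕ a ⟩ w) φ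
  ∫-⊙ u a w φ = ∫-⊖ (u ⊛⟨ suc (toℕ a) ⟩ w) (u ⊛⟨ toℕ a ⟩ w) φ

  -- Neither partial sum goes below the root of `u`, so they differ by the one summand labelled `a`.
  ∫-⊙-node : ∀ (u : BTree N) a → suc (toℕ a) ≤root u → ∀ w φ →
             ∫ (u ⊙⟨ a ⟩ w) φ ≈ φ (node u a w)
  ∫-⊙-node u a a<u w φ = begin
    ∫ (u ⊙⟨ a ⟩ w) φ
      ≈⟨ ∫-⊙ u a w φ ⟩
    ∫ (u ⊛⟨ suc (toℕ a) ⟩ w) φ - ∫ (u ⊛⟨ toℕ a ⟩ w) φ
      ≈⟨ +-cong (trans (∫-⊛-root _ u a<u w φ) (trans (∫-labels-suc a _) (+-comm _ _)))
                (-‿cong (∫-⊛-root _ u (≤root-weaken (ℕₚ.n≤1+n _) u a<u) w φ)) ⟩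
    φ (node u a w) + ∫ (labels (toℕ a)) _ - ∫ (labels (toℕ a)) _
      ≈⟨ //-rightDividesʳ _ _ ⟩
    φ (node u a w) ∎

  ⊛-zero : ∀ (u w : BTree N) φ → ∫ (u ⊛⟨ 0 ⟩ w) φ ≈ 0#
  ⊛-zero (leaf _)     w φ = refl
  ⊛-zero (node _ _ _) w φ = refl

  -- The operations for single labels are differences, so their sum telescopes: `⊛` really is S_k
  -- with respect to `⊙`.
  ∑-⊙ : ∀ {k} → k ≤ N → ∀ (u w : BTree N) φ →
        ∫ (labels k) (λ a → ∫ (u ⊙⟨ a ⟩ w) φ) ≈ ∫ (u ⊛⟨ k ⟩ w) φ
  ∑-⊙ {k = k} k≤N u w φ = begin
    ∫ (labels k) (λ a → ∫ (u ⊙⟨ a ⟩ w) φ)             ≈⟨ ∫-cong (labels k) (λ a → ∫-⊙ u a w φ) ⟩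
    ∫ (labels k) _                                    ≈⟨ ∫-labels-telescope k (λ j → ∫ (u ⊛⟨ j ⟩ w) φ) k≤N ⟩
    ∫ (u ⊛⟨ k ⟩ w) φ - ∫ (u ⊛⟨ 0 ⟩ w) φ               ≈⟨ +-congˡ (trans (-‿cong (⊛-zero u w φ)) -0#≈0#) ⟩
    ∫ (u ⊛⟨ k ⟩ w) φ + 0#                             ≈⟨ +-identityʳ _ ⟩
    ∫ (u ⊛⟨ k ⟩ w) φ                                  ∎

  ⊙-⊛-assoc : ∀ {a : Fin N} {k} → toℕ a < k → ∀ u v w φ →
              ∫ (u ⊙⟨ a ⟩ v) (λ t → ∫ (t ⊛⟨ k ⟩ w) φ) ≈
              ∫ (v ⊛⟨ k ⟩ w) (λ t → ∫ (u ⊙⟨ a ⟩ t) φ)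
  ⊙-⊛-assoc {a = a} {k} a<k u v w φ = begin
    ∫ (u ⊙⟨ a ⟩ v) (λ t → ∫ (t ⊛⟨ k ⟩ w) φ)
      ≈⟨ ∫-⊙ u a v _ ⟩
    ∫ (u ⊛⟨ suc (toℕ a) ⟩ v) _ - ∫ (u ⊛⟨ toℕ a ⟩ v) _
      ≈⟨ +-cong (⊛-assoc a<k u v w φ) (-‿cong (⊛-assoc (ℕₚ.<⇒≤ a<k) u v w φ)) ⟩
    ∫ (v ⊛⟨ k ⟩ w) _ - ∫ (v ⊛⟨ k ⟩ w) _
      ≈⟨ ∫-- (v ⊛⟨ k ⟩ w) _ _ ⟨
    ∫ (v ⊛⟨ k ⟩ w) _
      ≈⟨ ∫-cong (v ⊛⟨ k ⟩ w) (λ t → ∫-⊙ u a t φ) ⟨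
    ∫ (v ⊛⟨ k ⟩ w) (λ t → ∫ (u ⊙⟨ a ⟩ t) φ) ∎

  -- The difference of `⊙-⊛-assoc` at b + 1 and at b isolates the label `b`. The lower of the two
  -- bounds must still exceed `a`, hence the strict inequality.
  ⊙-switch : ∀ {a b : Fin N} → toℕ a < toℕ b → ∀ u v w φ →
             ∫ (u ⊙⟨ a ⟩ v) (λ t → ∫ (t ⊙⟨ b ⟩ w) φ) ≈
             ∫ (v ⊙⟨ b ⟩ w) (λ t → ∫ (u ⊙⟨ a ⟩ t) φ)
  ⊙-switch {a = a} {b} a<b u v w φ = begin
    ∫ (u ⊙⟨ a ⟩ v) (λ t → ∫ (t ⊙⟨ b ⟩ w) φ)
      ≈⟨ ∫-cong (u ⊙⟨ a ⟩ v) (λ t → ∫-⊙ t b w φ) ⟩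
    ∫ (u ⊙⟨ a ⟩ v) _
      ≈⟨ ∫-- (u ⊙⟨ a ⟩ v) _ _ ⟩
    ∫ (u ⊙⟨ a ⟩ v) _ - ∫ (u ⊙⟨ a ⟩ v) _
      ≈⟨ +-cong (⊙-⊛-assoc (ℕₚ.m<n⇒m<1+n a<b) u v w φ) (-‿cong (⊙-⊛-assoc a<b u v w φ)) ⟩
    ∫ (v ⊛⟨ suc (toℕ b) ⟩ w) _ - ∫ (v ⊛⟨ toℕ b ⟩ w) _
      ≈⟨ ∫-⊙ v b w _ ⟨
    ∫ (v ⊙⟨ b ⟩ w) (λ t → ∫ (u ⊙⟨ a ⟩ t) φ) ∎

  -- The relation proper sums over labels up to `b`. Summing over all labels adds only instances of
  -- `⊙-switch` and gives S_N, whose bound exceeds every `b`.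
  ⊙-absorb : ∀ (b : Fin N) u v w φ →
             ∫ allLabels (λ a → ∫ (u ⊙⟨ b ⟩ v) (λ t → ∫ (t ⊙⟨ a ⟩ w) φ)) ≈
             ∫ allLabels (λ a → ∫ (v ⊙⟨ a ⟩ w) (λ t → ∫ (u ⊙⟨ b ⟩ t) φ))
  ⊙-absorb {N = N} b u v w φ = begin
    ∫ allLabels (λ a → ∫ (u ⊙⟨ b ⟩ v) (λ t → ∫ (t ⊙⟨ a ⟩ w) φ))
      ≈⟨ ∫-swap allLabels (u ⊙⟨ b ⟩ v) _ ⟩
    ∫ (u ⊙⟨ b ⟩ v) (λ t → ∫ allLabels (λ a → ∫ (t ⊙⟨ a ⟩ w) φ))
      ≈⟨ ∫-cong (u ⊙⟨ b ⟩ v) (λ t → trans (∫-allLabels _) (∑-⊙ ℕₚ.≤-refl t w φ)) ⟩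
    ∫ (u ⊙⟨ b ⟩ v) (λ t → ∫ (t ⊛⟨ N ⟩ w) φ)
      ≈⟨ ⊙-⊛-assoc (Fin.toℕ<n b) u v w φ ⟩
    ∫ (v ⊛⟨ N ⟩ w) (λ t → ∫ (u ⊙⟨ b ⟩ t) φ)
      ≈⟨ trans (∫-allLabels _) (∑-⊙ ℕₚ.≤-refl v w _) ⟨
    ∫ allLabels (λ a → ∫ (v ⊙⟨ a ⟩ w) (λ t → ∫ (u ⊙⟨ b ⟩ t) φ)) ∎

  -- Evaluation of trees in the model

  eval : BTree N → (ℕ → BTree N) → Sums (BTree N)
  eval (leaf _)     ρ = pure (ρ 0)
  eval (node l a r) ρ = eval l ρ >>= λ u → eval r (ρ ∘ (#leaves l ℕ.+_)) >>= λ v → u ⊙⟨ a ⟩ v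

  ∫-eval-node : ∀ (l : BTree N) a r ρ φ →
    ∫ (eval (node l a r) ρ) φ ≈
    ∫ (eval l ρ) (λ u → ∫ (eval r (ρ ∘ (#leaves l ℕ.+_))) (λ v → ∫ (u ⊙⟨ a ⟩ v) φ))
  ∫-eval-node l a r ρ φ = trans (∫->>= (eval l ρ) _ φ)
    (∫-cong (eval l ρ) λ u → ∫->>= (eval r _) _ φ)

  -- The inputs `ρ` form a total function so that a right subtree can simply read them at an offset;
  -- this lemma says that the surplus entries do not matter.
  eval-cong : ∀ (t : BTree N) {ρ σ} → (∀ j → j < #leaves t → ρ j ≡ σ j) →
              ∀ φ → ∫ (eval t ρ) φ ≈ ∫ (eval t σ) φ
  eval-cong (leaf _)     {ρ} {σ} ρ≡σ φ = reflexive (≡.cong (λ x → ∫ (pure x) φ) (ρ≡σ 0 (s≤s z≤n)))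
  eval-cong (node l a r) {ρ} {σ} ρ≡σ φ = begin
    ∫ (eval (node l a r) ρ) φ
      ≈⟨ ∫-eval-node l a r ρ φ ⟩
    ∫ (eval l ρ) (λ u → ∫ (eval r (ρ ∘ (#leaves l ℕ.+_))) (λ v → ∫ (u ⊙⟨ a ⟩ v) φ))
      ≈⟨ eval-cong l (λ j j< → ρ≡σ j (ℕₚ.<-≤-trans j< (ℕₚ.m≤m+n _ _))) _ ⟩
    ∫ (eval l σ) (λ u → ∫ (eval r (ρ ∘ (#leaves l ℕ.+_))) (λ v → ∫ (u ⊙⟨ a ⟩ v) φ))
      ≈⟨ ∫-cong (eval l σ) (λ u → eval-cong r (λ j j< → ρ≡σ _ (ℕₚ.+-monoʳ-< (#leaves l) j<)) _) ⟩
    ∫ (eval l σ) (λ u → ∫ (eval r (σ ∘ (#leaves l ℕ.+_))) (λ v → ∫ (u ⊙⟨ a ⟩ v) φ))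
      ≈⟨ ∫-eval-node l a r σ φ ⟨
    ∫ (eval (node l a r) σ) φ ∎

  -- Normality puts every node in the situation of `∫-⊙-node`. This is what lets evaluation tell
  -- normal trees apart.
  eval-normal : ∀ (t : BTree N) → Normal t → ∀ φ → ∫ (eval t (λ _ → leaf tt)) φ ≈ φ t
  eval-normal (leaf tt)    _                    φ = ∫-pure (leaf tt) φ
  eval-normal (node l a r) (a<l , normˡ , normʳ) φ = begin
    ∫ (eval (node l a r) (λ _ → leaf tt)) φ
      ≈⟨ ∫-eval-node l a r (λ _ → leaf tt) φ ⟩
    ∫ (eval l (λ _ → leaf tt)) (λ u → ∫ (eval r (λ _ → leaf tt)) (λ v → ∫ (u ⊙⟨ a ⟩ v) φ))
      ≈⟨ eval-normal l normˡ _ ⟩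
    ∫ (eval r (λ _ → leaf tt)) (λ v → ∫ (l ⊙⟨ a ⟩ v) φ)
      ≈⟨ eval-normal r normʳ _ ⟩
    ∫ (l ⊙⟨ a ⟩ r) φ
      ≈⟨ ∫-⊙-node l a a<l r φ ⟩
    φ (node l a r) ∎

  -- plug i n x ρ replaces the n entries ρ i, …, ρ (i + n - 1) by the single entry x.
  plug : ∀ {X : Set} → ℕ → ℕ → X → (ℕ → X) → ℕ → X
  plug zero    n x ρ zero    = x
  plug zero    n x ρ (suc j) = ρ (n ℕ.+ j)
  plug (suc i) n x ρ zero    = ρ 0
  plug (suc i) n x ρ (suc j) = plug i n x (ρ ∘ suc) j

  module _ {X : Set} where

    plug-before : ∀ {i q} → q < i → ∀ n (x : X) ρ → plug i n x ρ q ≡ ρ q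
    plug-before {suc i} {zero}  _         n x ρ = ≡.refl
    plug-before {suc i} {suc q} (s≤s q<i) n x ρ = plug-before q<i n x (ρ ∘ suc)

    plug-shift : ∀ m i q n (x : X) ρ → plug (m ℕ.+ i) n x ρ (m ℕ.+ q) ≡ plug i n x (ρ ∘ (m ℕ.+_)) q
    plug-shift zero    i q n x ρ = ≡.refl
    plug-shift (suc m) i q n x ρ = plug-shift m i q n x (ρ ∘ suc)

    -- Here `m` and `m′` are the leaf counts of a left subtree before and after a graft at position
    -- `i`, related without subtraction as in `#leaves-graft`.
    plug-after : ∀ {i m m′} n → i < m → suc m′ ≡ m ℕ.+ n → ∀ q (x : X) ρ →
                 plug i n x ρ (m ℕ.+ q) ≡ ρ (m′ ℕ.+ q)
    plug-after {zero}  {suc m} {m′} n _ eq q x ρ = ≡.cong ρ (≡.trans (≡.sym (ℕₚ.+-assoc n m q))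
      (≡.cong (ℕ._+ q) (≡.trans (ℕₚ.+-comm n m) (≡.sym (ℕₚ.suc-injective eq)))))
    plug-after {suc i} {suc (suc m)} {suc m′} n (s≤s i<m) eq q x ρ =
      plug-after n i<m (ℕₚ.suc-injective eq) q x (ρ ∘ suc)
    plug-after {suc i} {suc (suc m)} {zero} n (s≤s i<m) () q x ρ
    plug-after {suc i} {suc zero} n (s≤s ()) eq q x ρ

  -- The grafted `s` consumes a block of `#leaves s` inputs and hands its value to `t` as one input.
  -- If the graft lies in the right subtree, the left one is evaluated before `s`, and the two
  -- totals have to be exchanged.
  eval-graft : ∀ (t : BTree N) i s ρ φ →
    ∫ (eval (graft t i s) ρ) φ ≈
    ∫ (eval s (ρ ∘ (toℕ i ℕ.+_))) (λ x → ∫ (eval t (plug (toℕ i) (#leaves s) x ρ)) φ)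
  eval-graft (leaf _) zero s ρ φ = ∫-cong (eval s ρ) λ x → sym (∫-pure x φ)
  eval-graft (node l a r) i s ρ φ with splitAt (#leaves l) i in eq
  ... | inj₁ j = begin
    ∫ (eval (node (graft l j s) a r) ρ) φ
      ≈⟨ ∫-eval-node (graft l j s) a r ρ φ ⟩
    ∫ (eval (graft l j s) ρ) (λ u → ∫ (eval r (ρ ∘ (#leaves (graft l j s) ℕ.+_))) (λ v → ∫ (u ⊙⟨ a ⟩ v) φ))
      ≈⟨ eval-graft l j s ρ _ ⟩
    ∫ (eval s (ρ ∘ (toℕ j ℕ.+_))) (λ x → ∫ (eval l (plug (toℕ j) n x ρ)) (λ u → ∫ (eval r (ρ ∘ (#leaves (graft l j s) ℕ.+_))) (λ v → ∫ (u ⊙⟨ a ⟩ v) φ)))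
      ≈⟨ ∫-cong (eval s _) (λ x → ∫-cong (eval l _) λ u → eval-cong r (λ q _ →
           plug-after n (Fin.toℕ<n j) (#leaves-graft l j s) q x ρ) _) ⟨
    ∫ (eval s (ρ ∘ (toℕ j ℕ.+_))) (λ x → ∫ (eval l (plug (toℕ j) n x ρ)) (λ u → ∫ (eval r (plug (toℕ j) n x ρ ∘ (#leaves l ℕ.+_))) (λ v → ∫ (u ⊙⟨ a ⟩ v) φ)))
      ≈⟨ ∫-cong (eval s _) (λ x → ∫-eval-node l a r (plug (toℕ j) n x ρ) φ) ⟨
    ∫ (eval s (ρ ∘ (toℕ j ℕ.+_))) (λ x → ∫ (eval (node l a r) (plug (toℕ j) n x ρ)) φ)
      ≈⟨ reflexive (≡.cong (λ i → ∫ (eval s (ρ ∘ (i ℕ.+_))) (λ x → ∫ (eval (node l a r) (plug i n x ρ)) φ)) i≡j) ⟨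
    ∫ (eval s (ρ ∘ (toℕ i ℕ.+_))) (λ x → ∫ (eval (node l a r) (plug (toℕ i) n x ρ)) φ) ∎
    where
    n = #leaves s
    i≡j : toℕ i ≡ toℕ j
    i≡j = ≡.trans (≡.cong toℕ (≡.sym (Fin.splitAt⁻¹-↑ˡ eq))) (Fin.toℕ-↑ˡ j _)
  ... | inj₂ j = begin
    ∫ (eval (node l a (graft r j s)) ρ) φ
      ≈⟨ ∫-eval-node l a (graft r j s) ρ φ ⟩
    ∫ (eval l ρ) (λ u → ∫ (eval (graft r j s) ρ′) (λ v → ∫ (u ⊙⟨ a ⟩ v) φ))
      ≈⟨ ∫-cong (eval l ρ) (λ u → eval-graft r j s ρ′ _) ⟩
    ∫ (eval l ρ) (λ u → ∫ (eval s (ρ′ ∘ (toℕ j ℕ.+_))) (λ x → ∫ (eval r (plug (toℕ j) n x ρ′)) (λ v → ∫ (u ⊙⟨ a ⟩ v) φ)))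
      ≈⟨ ∫-swap (eval l ρ) (eval s (ρ′ ∘ (toℕ j ℕ.+_))) _ ⟩
    ∫ (eval s (ρ′ ∘ (toℕ j ℕ.+_))) (λ x → ∫ (eval l ρ) (λ u → ∫ (eval r (plug (toℕ j) n x ρ′)) (λ v → ∫ (u ⊙⟨ a ⟩ v) φ)))
      ≈⟨ eval-cong s (λ q _ → ≡.cong ρ (≡.trans (≡.sym (ℕₚ.+-assoc m _ q)) (≡.cong (ℕ._+ q) (≡.sym i≡j)))) _ ⟩
    ∫ (eval s (ρ ∘ (toℕ i ℕ.+_))) (λ x → ∫ (eval l ρ) (λ u → ∫ (eval r (plug (toℕ j) n x ρ′)) (λ v → ∫ (u ⊙⟨ a ⟩ v) φ)))
      ≈⟨ ∫-cong (eval s _) (λ x → trans (∫-eval-node l a r (plug (toℕ i) n x ρ) φ) (trans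
           (eval-cong l (λ q q< → plug-before (ℕₚ.<-≤-trans q< (≡.subst (m ≤_) (≡.sym i≡j) (ℕₚ.m≤m+n m _))) n x ρ) _)
           (∫-cong (eval l ρ) λ u → eval-cong r (λ q _ →
             ≡.trans (≡.cong (λ i → plug i n x ρ (m ℕ.+ q)) i≡j) (plug-shift m (toℕ j) q n x ρ)) _))) ⟨
    ∫ (eval s (ρ ∘ (toℕ i ℕ.+_))) (λ x → ∫ (eval (node l a r) (plug (toℕ i) n x ρ)) φ) ∎
    where
    n = #leaves s
    m = #leaves l
    ρ′ = ρ ∘ (m ℕ.+_)
    i≡j : toℕ i ≡ m ℕ.+ toℕ j
    i≡j = ≡.trans (≡.cong toℕ (≡.sym (Fin.splitAt⁻¹-↑ʳ eq))) (Fin.toℕ-↑ʳ m j)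

-- Trees of arity three

leftComb rightComb : Fin N → Fin N → Monomial (Fin N) 3
leftComb  x y = node (node (leaf tt) y (leaf tt)) x (leaf tt) , ≡.refl
rightComb x y = node (leaf tt) x (node (leaf tt) y (leaf tt)) , ≡.refl

data Comb {N} : Monomial (Fin N) 3 → Set where
  left  : ∀ x y → Comb (leftComb x y)
  right : ∀ x y → Comb (rightComb x y)

1≤#leaves : ∀ (t : BTree N) → 1 ≤ #leaves t
1≤#leaves (leaf _)     = s≤s z≤n
1≤#leaves (node l _ r) = ℕₚ.≤-trans (1≤#leaves l) (ℕₚ.m≤m+n _ _)

+-tight : ∀ {a b x y} → a ≤ x → b ≤ y → x ℕ.+ y ≡ a ℕ.+ b → x ≡ a × y ≡ b
+-tight {a} {b} {x} {y} a≤x b≤y eq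
  = ℕₚ.≤-antisym (ℕₚ.+-cancelʳ-≤ b x a (ℕₚ.≤-trans (ℕₚ.+-monoʳ-≤ x b≤y) (ℕₚ.≤-reflexive eq))) a≤x
  , ℕₚ.≤-antisym (ℕₚ.+-cancelˡ-≤ a y b (ℕₚ.≤-trans (ℕₚ.+-monoˡ-≤ y a≤x) (ℕₚ.≤-reflexive eq))) b≤y

#leaves≡1 : ∀ (t : BTree N) → #leaves t ≡ 1 → t ≡ leaf tt
#leaves≡1 (leaf tt)    _  = ≡.refl
#leaves≡1 (node l _ r) eq = contradiction
  (≡.subst (2 ≤_) eq (ℕₚ.+-mono-≤ (1≤#leaves l) (1≤#leaves r))) λ { (s≤s ()) }

comb : ∀ (t : Monomial (Fin N) 3) → Comb t
comb (t , p) = go t (recompute (#leaves t ℕₚ.≟ 3) p)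
  where
  cherry : ∀ (l r : BTree _) → #leaves l ℕ.+ #leaves r ≡ 2 → l ≡ leaf tt × r ≡ leaf tt
  cherry l r eq with +-tight (1≤#leaves l) (1≤#leaves r) eq
  ... | l≡1 , r≡1 = #leaves≡1 l l≡1 , #leaves≡1 r r≡1

  go : ∀ t → (p : #leaves t ≡ 3) → Comb (t , p)
  go (node (leaf tt) x (node l y r)) p with cherry l r (ℕₚ.suc-injective p)
  ... | ≡.refl , ≡.refl = right x y
  go (node (node l y r) x s) p
    with +-tight (ℕₚ.+-mono-≤ (1≤#leaves l) (1≤#leaves r)) (1≤#leaves s) p
  ... | l+r≡2 , s≡1 with cherry l r l+r≡2 | #leaves≡1 s s≡1
  ... | ≡.refl , ≡.refl | ≡.refl = left x y

-- Evaluation annihilates the ideal of the Koszul dual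

module Annihilation (R : CommutativeRing r ℓr) (c : ℕ) where
  open CommutativeRing R hiding (zero)
  open SetoidReasoning setoid
  open RingProperties ring using (x≈y⇒x∙y⁻¹≈ε; -‿involutive; -1*x≈-x; -‿distribˡ-*; +-inverseˡ-unique; x[y-z]≈xy-xz)
  open Integral R
  open Model R
  open Hi R c
  open Unary using (_∈_)

  private
    A = Fin (suc c)
    T = BTree (suc c)

    _≟ᵐ_ : ∀ {n} → DecidableEquality (Monomial A n)
    _≟ᵐ_ = ≟-monomial Fin._≟_

  ind : Monomial A 3 → Monomial A 3 → Carrier
  ind = indicator _≟ᵐ_

  -- The sum over all monomials of arity 3.  The two of them in a summand are the
  -- ones that some relator of Hi identifies.
  expand : ∀ (f : Free 3) ψ → ∫ f ψ ≈
    ∫ allLabels (λ b → ∫ allLabels (λ a →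
      ∫ f (ind (leftComb a b)) * ψ (leftComb a b) + ∫ f (ind (rightComb b a)) * ψ (rightComb b a)))
  expand f ψ = begin
    ∫ f ψ
      ≈⟨ ∫-cong f (λ t → decompose t (comb t)) ⟩
    ∫ f (λ t → ∫ allLabels (λ b → ∫ allLabels (λ a → summand a b t)))
      ≈⟨ ∫-swap f allLabels _ ⟩
    ∫ allLabels (λ b → ∫ f (λ t → ∫ allLabels (λ a → summand a b t)))
      ≈⟨ ∫-cong allLabels (λ b → ∫-swap f allLabels _) ⟩
    ∫ allLabels (λ b → ∫ allLabels (λ a → ∫ f (summand a b)))
      ≈⟨ ∫-cong allLabels (λ b → ∫-cong allLabels λ a →
           trans (∫-+ f _ _) (+-cong (trans (∫-* _ f _) (*-comm _ _)) (trans (∫-* _ f _) (*-comm _ _)))) ⟩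
    ∫ allLabels (λ b → ∫ allLabels (λ a →
      ∫ f (ind (leftComb a b)) * ψ (leftComb a b) + ∫ f (ind (rightComb b a)) * ψ (rightComb b a))) ∎
    where
    summand : A → A → Monomial A 3 → Carrier
    summand a b t = ψ (leftComb a b) * ind (leftComb a b) t + ψ (rightComb b a) * ind (rightComb b a) t

    off : ∀ s t → s ≢ t → ψ s * ind s t ≈ 0#
    off s t s≢t = trans (*-congˡ (indicator-off _≟ᵐ_ s≢t)) (zeroʳ _)

    diag : ∀ t → ψ t * ind t t ≈ ψ t
    diag t = trans (*-congˡ (indicator-diag _≟ᵐ_ t)) (*-identityʳ _)

    decompose : ∀ t → Comb t → ψ t ≈ ∫ allLabels (λ b → ∫ allLabels (λ a → summand a b t))
    decompose _ (left x y) = sym (trans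
      (∫-allLabels-single y _ λ b b≢y → ∫-zero allLabels λ a →
        trans (+-cong (off (leftComb a b) (leftComb x y) (b≢y ∘ λ { ≡.refl → ≡.refl })) (off (rightComb b a) (leftComb x y) λ ())) (+-identityˡ _))
      (trans (∫-allLabels-single x _ λ a a≢x →
        trans (+-cong (off (leftComb a y) (leftComb x y) (a≢x ∘ λ { ≡.refl → ≡.refl })) (off (rightComb y a) (leftComb x y) λ ())) (+-identityˡ _))
      (trans (+-cong (diag (leftComb x y)) (off (rightComb y x) (leftComb x y) λ ())) (+-identityʳ _))))
    decompose _ (right x y) = sym (trans
      (∫-allLabels-single x _ λ b b≢x → ∫-zero allLabels λ a →
        trans (+-cong (off (leftComb a b) (rightComb x y) λ ()) (off (rightComb b a) (rightComb x y) (b≢x ∘ λ { ≡.refl → ≡.refl }))) (+-identityˡ _))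
      (trans (∫-allLabels-single y _ λ a a≢y →
        trans (+-cong (off (leftComb a x) (rightComb x y) λ ()) (off (rightComb x a) (rightComb x y) (a≢y ∘ λ { ≡.refl → ≡.refl }))) (+-identityˡ _))
      (trans (+-cong (off (leftComb y x) (rightComb x y) λ ()) (diag (rightComb x y))) (+-identityˡ _))))

  sign-indicator : ∀ s t → (if does (s ≟ᵐ t) then sign s else 0#) ≈ sign t * ind t s
  sign-indicator s t with s ≟ᵐ t
  ... | yes ≡.refl = sym (trans (*-congˡ (indicator-diag _≟ᵐ_ t)) (*-identityʳ _))
  ... | no s≢t     = sym (trans (*-congˡ (indicator-off _≟ᵐ_ (s≢t ∘ ≡.sym))) (zeroʳ _))

  -- With `h` as the outer sum, orthogonality of `f` can be checked by recursion on a proof that `h`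
  -- lies in a span.
  pairing : ∀ f h → ⟨ f , h ⟩ ≈ ∫ h (λ t → sign t * ∫ f (ind t))
  pairing f h = begin
    ⟨ f , h ⟩                                     ≈⟨ trans (extend≈∫ _≟ᵐ_ _ f) (∫-cong f λ s → extend≈∫ _≟ᵐ_ _ h) ⟩
    ∫ f (λ s → ∫ h (λ t → if does (s ≟ᵐ t) then sign s else 0#)) ≈⟨ ∫-cong f (λ s → ∫-cong h (sign-indicator s)) ⟩
    ∫ f (λ s → ∫ h (λ t → sign t * ind t s))      ≈⟨ ∫-swap f h _ ⟩
    ∫ h (λ t → ∫ f (λ s → sign t * ind t s))      ≈⟨ ∫-cong h (λ t → ∫-* (sign t) f (ind t)) ⟩
    ∫ h (λ t → sign t * ∫ f (ind t))              ∎

  relator : A → A → A → A → Free 3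
  relator x y x′ y′ = E x ∘⟨ 0F ⟩ E y ++ (- 1#) • (E x′ ∘⟨ 1F ⟩ E y′)

  -- The signs of the pairing and of the relators cancel.
  ∫-relator : ∀ (F : Monomial A 3 → Carrier) x y x′ y′ →
    ∫ (relator x y x′ y′) (λ t → sign t * F t) ≈
    F (leftComb x y) + F (rightComb x′ y′)
  ∫-relator F x y x′ y′ = +-cong positive (trans (+-identityʳ _) negative)
    where
    positive : (1# * 1#) * (1# * F (leftComb x y)) ≈ F (leftComb x y)
    positive = trans (*-cong (*-identityˡ _) (*-identityˡ _)) (*-identityˡ _)

    negative : ((- 1#) * (1# * 1#)) * ((- 1#) * F (rightComb x′ y′)) ≈ F (rightComb x′ y′)
    negative = begin
      ((- 1#) * (1# * 1#)) * ((- 1#) * F (rightComb x′ y′))   ≈⟨ *-congʳ (trans (*-congˡ (*-identityˡ _)) (*-identityʳ _)) ⟩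
      (- 1#) * ((- 1#) * F (rightComb x′ y′))                 ≈⟨ trans (-1*x≈-x _) (-‿cong (-1*x≈-x _)) ⟩
      - (- F (rightComb x′ y′))                               ≈⟨ -‿involutive _ ⟩
      F (rightComb x′ y′)                                     ∎

  ∫-eval-cherry : ∀ y (ρ : ℕ → T) φ →
    ∫ (eval (node (leaf tt) y (leaf tt)) ρ) φ ≈ ∫ (ρ 0 ⊙⟨ y ⟩ ρ 1) φ
  ∫-eval-cherry y ρ φ = trans (∫-eval-node (leaf tt) y (leaf tt) ρ φ)
    (trans (∫-pure (ρ 0) λ u → ∫ (pure (ρ 1)) λ v → ∫ (u ⊙⟨ y ⟩ v) φ)
           (∫-pure (ρ 1) λ v → ∫ (ρ 0 ⊙⟨ y ⟩ v) φ))

  Annihilates : (T → Carrier) → (ℕ → T) → ∀ {n} → Free n → Set ℓr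
  Annihilates φ ρ f = ∫ f (λ t → ∫ (eval (tree t) ρ) φ) ≈ 0#

  -- Orthogonality gives `leftComb a b` and `rightComb b a` opposite coefficients, so `f` evaluates
  -- to a combination of the differences `δ b a`. For fixed `b` all coefficients may be replaced by
  -- that of `leftComb b b`, and then `⊙-absorb` makes the sum over `a` vanish.
  annihilates-Relations⊥ : ∀ f → (Relations ⊥) f → ∀ ρ φ → Annihilates φ ρ f
  annihilates-Relations⊥ f f∈⊥ ρ φ = begin
    ∫ f ψ
      ≈⟨ expand f ψ ⟩
    ∫ allLabels (λ b → ∫ allLabels (λ a → F (leftComb a b) * ψ (leftComb a b) + F (rightComb b a) * ψ (rightComb b a)))
      ≈⟨ ∫-zero allLabels vanish ⟩
    0# ∎
    where
    F : Monomial A 3 → Carrier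
    F t = ∫ f (ind t)

    ψ : Monomial A 3 → Carrier
    ψ t = ∫ (eval (tree t) ρ) φ

    δ : A → A → Carrier
    δ b a = ψ (leftComb a b) - ψ (rightComb b a)

    ψ-left : ∀ x y → ψ (leftComb x y) ≈ ∫ (ρ 0 ⊙⟨ y ⟩ ρ 1) (λ t → ∫ (t ⊙⟨ x ⟩ ρ 2) φ)
    ψ-left x y = begin
      ψ (leftComb x y)
        ≈⟨ ∫-eval-node (node (leaf tt) y (leaf tt)) x (leaf tt) ρ φ ⟩
      ∫ (eval (node (leaf tt) y (leaf tt)) ρ) (λ u → ∫ (pure (ρ 2)) (λ v → ∫ (u ⊙⟨ x ⟩ v) φ))
        ≈⟨ ∫-cong (eval (node (leaf tt) y (leaf tt)) ρ) (λ u → ∫-pure (ρ 2) λ v → ∫ (u ⊙⟨ x ⟩ v) φ) ⟩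
      ∫ (eval (node (leaf tt) y (leaf tt)) ρ) (λ u → ∫ (u ⊙⟨ x ⟩ ρ 2) φ)
        ≈⟨ ∫-eval-cherry y ρ _ ⟩
      ∫ (ρ 0 ⊙⟨ y ⟩ ρ 1) (λ t → ∫ (t ⊙⟨ x ⟩ ρ 2) φ) ∎

    ψ-right : ∀ x y → ψ (rightComb x y) ≈ ∫ (ρ 1 ⊙⟨ y ⟩ ρ 2) (λ t → ∫ (ρ 0 ⊙⟨ x ⟩ t) φ)
    ψ-right x y = begin
      ψ (rightComb x y)
        ≈⟨ trans (∫-eval-node (leaf tt) x (node (leaf tt) y (leaf tt)) ρ φ) (∫-pure (ρ 0) λ u → ∫ (eval (node (leaf tt) y (leaf tt)) (ρ ∘ suc)) λ v → ∫ (u ⊙⟨ x ⟩ v) φ) ⟩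
      ∫ (eval (node (leaf tt) y (leaf tt)) (ρ ∘ suc)) (λ v → ∫ (ρ 0 ⊙⟨ x ⟩ v) φ)
        ≈⟨ ∫-eval-cherry y (ρ ∘ suc) _ ⟩
      ∫ (ρ 1 ⊙⟨ y ⟩ ρ 2) (λ t → ∫ (ρ 0 ⊙⟨ x ⟩ t) φ) ∎

    F-relator : ∀ x y x′ y′ → relator x y x′ y′ ∈ Relations →
                F (leftComb x y) ≈ - F (rightComb x′ y′)
    F-relator x y x′ y′ r∈ = +-inverseˡ-unique _ _
      (trans (sym (∫-relator F x y x′ y′)) (trans (sym (pairing f (relator x y x′ y′))) (f∈⊥ _ r∈)))

    absorbed : ∀ {a a′ b} → a Fin.≤ b → a′ Fin.≤ b → F (leftComb a b) ≈ - F (rightComb b a′)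
    absorbed a≤b a′≤b = F-relator _ _ _ _ (generator (absorb a≤b a′≤b))

    switched : ∀ {a b} → a Fin.< b → F (leftComb b a) ≈ - F (rightComb a b)
    switched a<b = F-relator _ _ _ _ (generator (switch a<b))

    F-right≈-F-left : ∀ a b → F (rightComb b a) ≈ - F (leftComb a b)
    F-right≈-F-left a b with ℕₚ.≤-<-connex (toℕ a) (toℕ b)
    ... | inj₁ a≤b = sym (trans (-‿cong (absorbed a≤b a≤b)) (-‿involutive _))
    ... | inj₂ b<a = sym (trans (-‿cong (switched b<a)) (-‿involutive _))

    -- δ b a vanishes unless a ≤ b, where the coefficient of leftComb a b does not depend on a.
    F-constant : ∀ b a → F (leftComb a b) * δ b a ≈ F (leftComb b b) * δ b a
    F-constant b a with ℕₚ.≤-<-connex (toℕ a) (toℕ b)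
    ... | inj₁ a≤b = *-congʳ (trans (absorbed a≤b a≤b) (sym (absorbed ℕₚ.≤-refl a≤b)))
    ... | inj₂ b<a = trans (*-congˡ δ≈0) (trans (zeroʳ _) (sym (trans (*-congˡ δ≈0) (zeroʳ _))))
      where
      δ≈0 : δ b a ≈ 0#
      δ≈0 = x≈y⇒x∙y⁻¹≈ε (trans (ψ-left a b) (trans (⊙-switch b<a (ρ 0) (ρ 1) (ρ 2) φ) (sym (ψ-right b a))))

    vanish : ∀ b → ∫ allLabels (λ a → F (leftComb a b) * ψ (leftComb a b) + F (rightComb b a) * ψ (rightComb b a)) ≈ 0#
    vanish b = begin
      ∫ allLabels (λ a → F (leftComb a b) * ψ (leftComb a b) + F (rightComb b a) * ψ (rightComb b a))
        ≈⟨ ∫-cong allLabels (λ a → trans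
             (+-congˡ (trans (*-congʳ (F-right≈-F-left a b)) (sym (-‿distribˡ-* _ _))))
             (trans (sym (x[y-z]≈xy-xz _ _ _)) (F-constant b a))) ⟩
      ∫ allLabels (λ a → F (leftComb b b) * δ b a)
        ≈⟨ ∫-* _ allLabels (δ b) ⟩
      F (leftComb b b) * ∫ allLabels (δ b)
        ≈⟨ *-congˡ (trans (∫-- allLabels _ _) (x≈y⇒x∙y⁻¹≈ε (begin
             ∫ allLabels (λ a → ψ (leftComb a b))
               ≈⟨ ∫-cong allLabels (λ a → ψ-left a b) ⟩
             ∫ allLabels _
               ≈⟨ ⊙-absorb b (ρ 0) (ρ 1) (ρ 2) φ ⟩
             ∫ allLabels _
               ≈⟨ ∫-cong allLabels (λ a → ψ-right b a) ⟨
             ∫ allLabels (λ a → ψ (rightComb b a)) ∎))) ⟩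
      F (leftComb b b) * 0#
        ≈⟨ zeroʳ _ ⟩
      0# ∎

  ∫-∘ : ∀ {m n} (f : Free m) i (g : Free n) φ →
        ∫ (f ∘⟨ i ⟩ g) φ ≈ ∫ f (λ s → ∫ g (λ t → φ (s ∘ᵐ⟨ i ⟩ t)))
  ∫-∘ []            i g φ = refl
  ∫-∘ ((k , s) ∷ f) i g φ = trans (∫-++ (map _ g) (f ∘⟨ i ⟩ g) φ) (+-cong (row g) (∫-∘ f i g φ))
    where
    row : ∀ g → ∫ (map (λ (l , t) → k * l , s ∘ᵐ⟨ i ⟩ t) g) φ ≈ k * ∫ g (λ t → φ (s ∘ᵐ⟨ i ⟩ t))
    row []            = sym (zeroʳ k)
    row ((l , t) ∷ g) = trans (+-cong (*-assoc k l _) (row g)) (sym (distribˡ k _ _))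

  eval-∘ᵐ : ∀ {m n} (t : Monomial A m) i (s : Monomial A n) ρ φ →
    ∫ (eval (tree (t ∘ᵐ⟨ i ⟩ s)) ρ) φ ≈
    ∫ (eval (tree s) (ρ ∘ (toℕ i ℕ.+_))) (λ x → ∫ (eval (tree t) (plug (toℕ i) n x ρ)) φ)
  eval-∘ᵐ {n = n} (t , p) i (s , q) ρ φ = trans (eval-graft t (cast (≡.sym p) i) s ρ φ)
    (reflexive (≡.cong₂ (λ i n → ∫ (eval s (ρ ∘ (i ℕ.+_))) (λ x → ∫ (eval t (plug i n x ρ)) φ))
      (Fin.toℕ-cast (≡.sym p) i) (recompute (#leaves s ℕₚ.≟ n) q)))

  -- The quantifiers over `ρ` and `φ` carry the induction. Composing on the right of `f` plugs new
  -- values into `ρ`; composing on the left of `g` shifts `ρ` and replaces `φ` by the evaluation of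
  -- the surrounding tree.
  annihilates-Ideal : ∀ {n} {f : Free n} → Ideal (Relations ⊥) n f → ∀ ρ φ → Annihilates φ ρ f
  annihilates-Ideal (generator {f} f∈)          ρ φ = annihilates-Relations⊥ f f∈ ρ φ
  annihilates-Ideal (resp {f = f} {g} f≋g f∈)   ρ φ =
    trans (sym (∫-resp-≋ _≟ᵐ_ {f} {g} f≋g _)) (annihilates-Ideal f∈ ρ φ)
  annihilates-Ideal zeroᴹ                       ρ φ = refl
  annihilates-Ideal (plus {f = f} {g} f∈ g∈)    ρ φ = trans (∫-++ f g _)
    (trans (+-cong (annihilates-Ideal f∈ ρ φ) (annihilates-Ideal g∈ ρ φ)) (+-identityˡ _))
  annihilates-Ideal (scale k {f} f∈)            ρ φ =
    trans (∫-• k f _) (trans (*-congˡ (annihilates-Ideal f∈ ρ φ)) (zeroʳ k))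
  annihilates-Ideal (composeˡ {n = n} {f} i g f∈) ρ φ = begin
    ∫ (f ∘⟨ i ⟩ g) (λ t → ∫ (eval (tree t) ρ) φ)
      ≈⟨ ∫-∘ f i g _ ⟩
    ∫ f (λ t → ∫ g (λ s → ∫ (eval (tree (t ∘ᵐ⟨ i ⟩ s)) ρ) φ))
      ≈⟨ ∫-swap f g _ ⟩
    ∫ g (λ s → ∫ f (λ t → ∫ (eval (tree (t ∘ᵐ⟨ i ⟩ s)) ρ) φ))
      ≈⟨ ∫-zero g (λ s → trans (∫-cong f λ t → eval-∘ᵐ t i s ρ φ)
           (trans (∫-swap f (eval (tree s) _) _)
             (∫-zero (eval (tree s) _) λ x → annihilates-Ideal f∈ (plug (toℕ i) n x ρ) φ))) ⟩
    0# ∎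
  annihilates-Ideal (composeʳ f i {g} g∈) ρ φ = begin
    ∫ (f ∘⟨ i ⟩ g) (λ t → ∫ (eval (tree t) ρ) φ)
      ≈⟨ ∫-∘ f i g _ ⟩
    ∫ f (λ t → ∫ g (λ s → ∫ (eval (tree (t ∘ᵐ⟨ i ⟩ s)) ρ) φ))
      ≈⟨ ∫-zero f (λ t → trans (∫-cong g λ s → eval-∘ᵐ t i s ρ φ)
           (annihilates-Ideal g∈ (ρ ∘ (toℕ i ℕ.+_)) _)) ⟩
    0# ∎

-- Spanning by normal trees

-- Only the irrelevant arity proof changes, so the underlying tree computes through the cast.
castᵐ : ∀ {A m n} → .(m ≡ n) → Monomial A m → Monomial A n
castᵐ m≡n (t , p) = t , ≡.trans p m≡n

joinˡ : ∀ {A m} → A → (w : Tree A ⊤) → Monomial A m → Monomial A (m ℕ.+ #leaves w)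
joinˡ a w (t , p) = node t a w , ≡.cong (ℕ._+ #leaves w) p

joinʳ : ∀ {A n} → (u : Tree A ⊤) → A → Monomial A n → Monomial A (#leaves u ℕ.+ n)
joinʳ u a (t , p) = node u a t , ≡.cong (#leaves u ℕ.+_) p

module Spanning (R : CommutativeRing r ℓr) (c : ℕ) where
  open CommutativeRing R hiding (zero)
  open SetoidReasoning setoid
  open RingProperties ring using (x≈y⇒x∙y⁻¹≈ε; -‿involutive; -0#≈0#; -‿+-comm; x[y-z]≈xy-xz; //-rightDividesʳ)
  open CommutativeSemigroupProperties
    (CommutativeMonoid.commutativeSemigroup +-commutativeMonoid) using (interchange)
  open Integral R
  open Model R
  open Hi R c
  open Unary using (_∈_)
  open Annihilation R c

  private
    A = Fin (suc c)
    T = BTree (suc c)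

    _≟ᵐ_ : ∀ {n} → DecidableEquality (Monomial A n)
    _≟ᵐ_ = ≟-monomial Fin._≟_

    I : ∀ n → Pred (Free n) _
    I = Ideal (Relations ⊥)

  module _ {k : ℕ} {y : A} (y<k : toℕ y < k) where

    opaque
      -- The relation u y (v S_k w) - (u y v) S_k w, as an element of arity three.
      redistribution : Free 3
      redistribution = map (map₂ λ a → rightComb y a) (labels k) ⊖ map (map₂ λ a → leftComb a y) (labels k)

      ∫-redistribution : ∀ φ → ∫ redistribution φ ≈
        ∫ (labels k) (λ a → φ (rightComb y a)) - ∫ (labels k) (λ a → φ (leftComb a y))
      ∫-redistribution φ = trans (∫-⊖ (map (map₂ λ a → rightComb y a) (labels k)) (map (map₂ λ a → leftComb a y) (labels k)) φ)
        (+-cong (∫-map _ (labels k) φ) (-‿cong (∫-map _ (labels k) φ)))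

    private
      F : Monomial A 3 → Carrier
      F t = ∫ redistribution (ind t)

      F-right : ∀ x a → F (rightComb x a) ≈ ∫ (labels k) (λ a′ → ind (rightComb x a) (rightComb y a′))
      F-right x a = trans (∫-redistribution _) (trans
        (+-congˡ (trans (-‿cong (∫-zero (labels k) λ a′ → indicator-off _≟ᵐ_ {rightComb x a} {leftComb a′ y} λ ())) -0#≈0#))
        (+-identityʳ _))

      F-left : ∀ x a → F (leftComb a x) ≈ - ∫ (labels k) (λ a′ → ind (leftComb a x) (leftComb a′ y))
      F-left x a = trans (∫-redistribution _) (trans
        (+-congʳ (∫-zero (labels k) λ a′ → indicator-off _≟ᵐ_ {leftComb a x} {rightComb y a′} λ ()))
        (+-identityˡ _))

      F-right-off : ∀ {x} a → x ≢ y → F (rightComb x a) ≈ 0#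
      F-right-off {x} a x≢y = trans (F-right x a) (∫-zero (labels k) λ a′ →
        indicator-off _≟ᵐ_ {rightComb x a} {rightComb y a′} (x≢y ∘ λ { ≡.refl → ≡.refl }))

      F-left-off : ∀ {x} a → x ≢ y → F (leftComb a x) ≈ 0#
      F-left-off {x} a x≢y = trans (F-left x a) (trans (-‿cong (∫-zero (labels k) λ a′ →
        indicator-off _≟ᵐ_ {leftComb a x} {leftComb a′ y} (x≢y ∘ λ { ≡.refl → ≡.refl }))) -0#≈0#)

      F-right-on : ∀ a → toℕ a < k → F (rightComb y a) ≈ 1#
      F-right-on a a<k = trans (F-right y a) (trans
        (∫-labels-single a a<k _ λ a′ a′≢a → indicator-off _≟ᵐ_ {rightComb y a} {rightComb y a′} (a′≢a ∘ λ { ≡.refl → ≡.refl }))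
        (indicator-diag _≟ᵐ_ (rightComb y a)))

      F-left-on : ∀ a → toℕ a < k → F (leftComb a y) ≈ - 1#
      F-left-on a a<k = trans (F-left y a) (-‿cong (trans
        (∫-labels-single a a<k _ λ a′ a′≢a → indicator-off _≟ᵐ_ {leftComb a y} {leftComb a′ y} (a′≢a ∘ λ { ≡.refl → ≡.refl }))
        (indicator-diag _≟ᵐ_ (leftComb a y))))

      ind-left≈ind-right : ∀ a a′ → ind (leftComb a y) (leftComb a′ y) ≈ ind (rightComb y a) (rightComb y a′)
      ind-left≈ind-right a a′ = cases (a Fin.≟ a′)
        where
        cases : _ → ind (leftComb a y) (leftComb a′ y) ≈ ind (rightComb y a) (rightComb y a′)
        cases (yes ≡.refl) = trans (indicator-diag _≟ᵐ_ (leftComb a y)) (sym (indicator-diag _≟ᵐ_ (rightComb y a)))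
        cases (no a≢a′)    = trans (indicator-off _≟ᵐ_ {leftComb a y} {leftComb a′ y} (a≢a′ ∘ λ { ≡.refl → ≡.refl }))
          (sym (indicator-off _≟ᵐ_ {rightComb y a} {rightComb y a′} (a≢a′ ∘ λ { ≡.refl → ≡.refl })))

      χ : Monomial A 3 → Carrier
      χ t = sign t * F t

      orthogonal : ∀ {h} → h ∈ Relations → ∫ h χ ≈ 0#
      orthogonal (generator (absorb {a} {a′} {b} a≤b a′≤b)) = trans (∫-relator F a b b a′) (cases (b Fin.≟ y))
        where
        cases : _ → F (leftComb a b) + F (rightComb b a′) ≈ 0#
        -- Both `a` and `a′` are at most `y`, hence below `k`: the two monomials occur, with
        -- coefficients -1 and 1.
        cases (yes ≡.refl) = trans (+-cong (F-left-on a (ℕₚ.≤-<-trans a≤b y<k)) (F-right-on a′ (ℕₚ.≤-<-trans a′≤b y<k)))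
          (-‿inverseˡ _)
        cases (no b≢y)     = trans (+-cong (F-left-off a b≢y) (F-right-off a′ b≢y)) (+-identityˡ _)
      orthogonal (generator (switch {a} {b} a<b)) = trans (∫-relator F b a a b) (cases (a Fin.≟ y))
        where
        cases : _ → F (leftComb b a) + F (rightComb a b) ≈ 0#
        -- Nothing relates `b` to `k`: either both monomials occur or neither does, so the
        -- coefficients are compared as sums of indicators.
        cases (yes ≡.refl) = trans (+-cong (F-left y b) (F-right y b))
          (trans (+-congˡ (sym (∫-cong (labels k) (ind-left≈ind-right b)))) (-‿inverseˡ _))
        cases (no a≢y)     = trans (+-cong (F-left-off b a≢y) (F-right-off b a≢y)) (+-identityˡ _)
      orthogonal (resp {x = f} {g} f≋g f∈) = trans (sym (∫-resp-≋ _≟ᵐ_ {f} {g} f≋g χ)) (orthogonal f∈)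
      orthogonal zeroᴹ                     = refl
      orthogonal (plus {x = f} {g} f∈ g∈)  =
        trans (∫-++ f g χ) (trans (+-cong (orthogonal f∈) (orthogonal g∈)) (+-identityˡ _))
      orthogonal (scale k {f} f∈)          =
        trans (∫-• k f χ) (trans (*-congˡ (orthogonal f∈)) (zeroʳ k))

    redistribution∈⊥ : redistribution ∈ Relations ⊥
    redistribution∈⊥ h h∈ = trans (pairing redistribution h) (orthogonal h∈)

  ideal-resp : ∀ {n} {f g : Free n} → (∀ φ → ∫ f φ ≈ ∫ g φ) → f ∈ I n → g ∈ I n
  ideal-resp {f = f} {g} f≈g = resp (∫⇒≋ _≟ᵐ_ {f} {g} f≈g)

  ideal-castᵐ : ∀ {m n} (m≡n : m ≡ n) {f : Free m} → f ∈ I m → map (map₂ (castᵐ m≡n)) f ∈ I n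
  ideal-castᵐ ≡.refl {f} = ideal-resp λ φ → sym (∫-map (castᵐ ≡.refl) f φ)

  single : ∀ (t : T) → Free (#leaves t)
  single t = pure (t , ≡.refl)

  ∫-∘-single : ∀ {m} (f : Free m) i t φ → ∫ (f ∘⟨ i ⟩ single t) φ ≈ ∫ f (λ s → φ (s ∘ᵐ⟨ i ⟩ (t , ≡.refl)))
  ∫-∘-single f i t φ = trans (∫-∘ f i (single t) φ) (∫-cong f λ s → ∫-pure (t , ≡.refl) λ t → φ (s ∘ᵐ⟨ i ⟩ t))

  ∫-E-∘ : ∀ {n} a i (f : Free n) φ → ∫ (E a ∘⟨ i ⟩ f) φ ≈ ∫ f (λ t → φ (corolla a ∘ᵐ⟨ i ⟩ t))
  ∫-E-∘ a i f φ = trans (∫-∘ (E a) i f φ) (∫-pure (corolla a) λ s → ∫ f λ t → φ (s ∘ᵐ⟨ i ⟩ t))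

  -- The leaves of the corolla are filled from right to left: the positions still to be filled are
  -- then not shifted and stay literals, so the grafts compute.
  ideal-joinʳ : ∀ (u : T) a {n} {f : Free n} → f ∈ I n → map (map₂ (joinʳ u a)) f ∈ I (#leaves u ℕ.+ n)
  ideal-joinʳ u a {n} {f} f∈ = ideal-resp
    (λ φ → begin
      ∫ (map (map₂ κ) (E a ∘⟨ 1F ⟩ f ∘⟨ 0F ⟩ single u)) φ
        ≈⟨ ∫-map κ (E a ∘⟨ 1F ⟩ f ∘⟨ 0F ⟩ single u) φ ⟩
      ∫ (E a ∘⟨ 1F ⟩ f ∘⟨ 0F ⟩ single u) (φ ∘ κ)
        ≈⟨ ∫-∘-single (E a ∘⟨ 1F ⟩ f) 0F u (φ ∘ κ) ⟩
      ∫ (E a ∘⟨ 1F ⟩ f) (λ t → φ (κ (t ∘ᵐ⟨ 0F ⟩ (u , ≡.refl))))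
        ≈⟨ ∫-E-∘ a 1F f (λ t → φ (κ (t ∘ᵐ⟨ 0F ⟩ (u , ≡.refl)))) ⟩
      ∫ f (φ ∘ joinʳ u a)
        ≈⟨ ∫-map (joinʳ u a) f φ ⟨
      ∫ (map (map₂ (joinʳ u a)) f) φ ∎)
    (ideal-castᵐ (ℕₚ.+-comm n _) (composeˡ 0F (single u) (composeʳ (E a) 1F f∈)))
    where
    κ : Monomial A (n ℕ.+ #leaves u) → Monomial A (#leaves u ℕ.+ n)
    κ = castᵐ (ℕₚ.+-comm n _)

  ideal-joinˡ : ∀ a (w : T) {n} {f : Free n} → f ∈ I n → map (map₂ (joinˡ a w)) f ∈ I (n ℕ.+ #leaves w)
  ideal-joinˡ a w {n} {f} f∈ = ideal-resp
    (λ φ → begin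
      ∫ (map (map₂ κ) (E a ∘⟨ 1F ⟩ single w ∘⟨ 0F ⟩ f)) φ
        ≈⟨ ∫-map κ (E a ∘⟨ 1F ⟩ single w ∘⟨ 0F ⟩ f) φ ⟩
      ∫ (E a ∘⟨ 1F ⟩ single w ∘⟨ 0F ⟩ f) (φ ∘ κ)
        ≈⟨ ∫-∘ (E a ∘⟨ 1F ⟩ single w) 0F f (φ ∘ κ) ⟩
      ∫ (E a ∘⟨ 1F ⟩ single w) (λ s → ∫ f (λ t → φ (κ (s ∘ᵐ⟨ 0F ⟩ t))))
        ≈⟨ ∫-∘-single (E a) 1F w (λ s → ∫ f (λ t → φ (κ (s ∘ᵐ⟨ 0F ⟩ t)))) ⟩
      ∫ (E a) (λ s → ∫ f (λ t → φ (κ (s ∘ᵐ⟨ 1F ⟩ (w , ≡.refl) ∘ᵐ⟨ 0F ⟩ t))))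
        ≈⟨ ∫-pure (corolla a) (λ s → ∫ f (λ t → φ (κ (s ∘ᵐ⟨ 1F ⟩ (w , ≡.refl) ∘ᵐ⟨ 0F ⟩ t)))) ⟩
      ∫ f (φ ∘ joinˡ a w)
        ≈⟨ ∫-map (joinˡ a w) f φ ⟨
      ∫ (map (map₂ (joinˡ a w)) f) φ ∎)
    (ideal-castᵐ (ℕₚ.+-comm _ n) (composeʳ (E a ∘⟨ 1F ⟩ single w) 0F f∈))
    where
    κ : Monomial A (#leaves w ℕ.+ n) → Monomial A (n ℕ.+ #leaves w)
    κ = castᵐ (ℕₚ.+-comm _ n)

  -- This is u S_k w as written in the free operad, whereas `⊛` is the outcome of rewriting it.
  branches : ℕ → (u w : T) → Free (#leaves u ℕ.+ #leaves w)
  branches k u w = map (map₂ λ a → node u a w , ≡.refl) (labels k)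

  ∫-branches : ∀ k u w φ → ∫ (branches k u w) φ ≈ ∫ (labels k) (λ a → φ (node u a w , ≡.refl))
  ∫-branches k u w φ = ∫-map _ (labels k) φ

  reassociate : (u v w : T) → Monomial A (#leaves u ℕ.+ (#leaves v ℕ.+ #leaves w)) →
                Monomial A (#leaves u ℕ.+ #leaves v ℕ.+ #leaves w)
  reassociate u v w = castᵐ (≡.sym (ℕₚ.+-assoc (#leaves u) _ _))

  rotate : ℕ → (u₁ : T) (y : A) (u₂ w : T) → Free (#leaves u₁ ℕ.+ #leaves u₂ ℕ.+ #leaves w)
  rotate k u₁ y u₂ w = map (map₂ (reassociate u₁ u₂ w)) (map (map₂ (joinʳ u₁ y)) (branches k u₂ w))

  ∫-rotate : ∀ k u₁ y u₂ w φ → ∫ (rotate k u₁ y u₂ w) φ ≈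
    ∫ (labels k) (λ a → φ (reassociate u₁ u₂ w (node u₁ y (node u₂ a w) , ≡.refl)))
  ∫-rotate k u₁ y u₂ w φ = begin
    ∫ (rotate k u₁ y u₂ w) φ
      ≈⟨ ∫-map (reassociate u₁ u₂ w) (map (map₂ (joinʳ u₁ y)) (branches k u₂ w)) φ ⟩
    ∫ (map (map₂ (joinʳ u₁ y)) (branches k u₂ w)) (φ ∘ reassociate u₁ u₂ w)
      ≈⟨ ∫-map (joinʳ u₁ y) (branches k u₂ w) (φ ∘ reassociate u₁ u₂ w) ⟩
    ∫ (branches k u₂ w) (φ ∘ reassociate u₁ u₂ w ∘ joinʳ u₁ y)
      ≈⟨ ∫-branches k u₂ w (φ ∘ reassociate u₁ u₂ w ∘ joinʳ u₁ y) ⟩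
    ∫ (labels k) (λ a → φ (reassociate u₁ u₂ w (node u₁ y (node u₂ a w) , ≡.refl))) ∎

  -- Grafting `w`, `u₂` and `u₁` onto the three leaves of `redistribution`, again from right to
  -- left, gives exactly this difference up to a cast of the arity.
  rotation∈ideal : ∀ {k y} → toℕ y < k → ∀ (u₁ u₂ w : T) →
                   rotate k u₁ y u₂ w ⊖ branches k (node u₁ y u₂) w ∈ I _
  rotation∈ideal {k} {y} y<k u₁ u₂ w = ideal-resp
    (λ φ → begin
      ∫ (map (map₂ κ) (ρ ∘⟨ 2F ⟩ single w ∘⟨ 1F ⟩ single u₂ ∘⟨ 0F ⟩ single u₁)) φ
        ≈⟨ ∫-map κ (ρ ∘⟨ 2F ⟩ single w ∘⟨ 1F ⟩ single u₂ ∘⟨ 0F ⟩ single u₁) φ ⟩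
      ∫ (ρ ∘⟨ 2F ⟩ single w ∘⟨ 1F ⟩ single u₂ ∘⟨ 0F ⟩ single u₁) (φ ∘ κ)
        ≈⟨ ∫-∘-single (ρ ∘⟨ 2F ⟩ single w ∘⟨ 1F ⟩ single u₂) 0F u₁ (φ ∘ κ) ⟩
      ∫ (ρ ∘⟨ 2F ⟩ single w ∘⟨ 1F ⟩ single u₂) (λ t → φ (κ (t ∘ᵐ⟨ 0F ⟩ (u₁ , ≡.refl))))
        ≈⟨ ∫-∘-single (ρ ∘⟨ 2F ⟩ single w) 1F u₂ (λ t → φ (κ (t ∘ᵐ⟨ 0F ⟩ (u₁ , ≡.refl)))) ⟩
      ∫ (ρ ∘⟨ 2F ⟩ single w) (λ t → φ (κ (t ∘ᵐ⟨ 1F ⟩ (u₂ , ≡.refl) ∘ᵐ⟨ 0F ⟩ (u₁ , ≡.refl))))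
        ≈⟨ ∫-∘-single ρ 2F w (λ t → φ (κ (t ∘ᵐ⟨ 1F ⟩ (u₂ , ≡.refl) ∘ᵐ⟨ 0F ⟩ (u₁ , ≡.refl)))) ⟩
      ∫ ρ (λ t → φ (κ (t ∘ᵐ⟨ 2F ⟩ (w , ≡.refl) ∘ᵐ⟨ 1F ⟩ (u₂ , ≡.refl) ∘ᵐ⟨ 0F ⟩ (u₁ , ≡.refl))))
        ≈⟨ ∫-redistribution y<k _ ⟩
      ∫ (labels k) (λ a → φ (reassociate u₁ u₂ w (node u₁ y (node u₂ a w) , ≡.refl)))
        - ∫ (labels k) (λ a → φ (node (node u₁ y u₂) a w , ≡.refl))
        ≈⟨ +-cong (∫-rotate k u₁ y u₂ w φ) (-‿cong (∫-branches k (node u₁ y u₂) w φ)) ⟨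
      ∫ (rotate k u₁ y u₂ w) φ - ∫ (branches k (node u₁ y u₂) w) φ
        ≈⟨ ∫-⊖ (rotate k u₁ y u₂ w) (branches k (node u₁ y u₂) w) φ ⟨
      ∫ (rotate k u₁ y u₂ w ⊖ branches k (node u₁ y u₂) w) φ ∎)
    (ideal-castᵐ arities (composeˡ 0F (single u₁) (composeˡ 1F (single u₂) (composeˡ 2F (single w)
      (generator {f = ρ} (redistribution∈⊥ y<k))))))
    where
    ρ = redistribution y<k

    rearrange : ∀ x y z → x ℕ.+ y ℕ.+ z ≡ z ℕ.+ y ℕ.+ x
    rearrange = solve-∀

    arities : #leaves w ℕ.+ #leaves u₂ ℕ.+ #leaves u₁ ≡ #leaves u₁ ℕ.+ #leaves u₂ ℕ.+ #leaves w
    arities = rearrange (#leaves w) (#leaves u₂) (#leaves u₁)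

    κ : Monomial A (#leaves w ℕ.+ #leaves u₂ ℕ.+ #leaves u₁) → Monomial A (#leaves u₁ ℕ.+ #leaves u₂ ℕ.+ #leaves w)
    κ = castᵐ arities

  -- Reduction to normal trees

  Hi!ᶜ : ∀ n → Module R _ _
  Hi!ᶜ = koszulDual Relations

  -- Generated inductively instead of asking for coefficients, so that attaching a further subtree
  -- to every term is a plain recursion (`reducible-map`). Coefficients are extracted only in
  -- `spanning`.
  data Reducible {n} : Pred (Free n) (r ⊔ ℓr) where
    normal : ∀ t → Normal (tree t) → Reducible (pure t)
    resp   : ∀ {f g} → f ⊖ g ∈ I n → Reducible f → Reducible g
    zeroᴹ  : Reducible []
    plus   : ∀ {f g} → Reducible f → Reducible g → Reducible (f ++ g)
    scale  : ∀ k {f} → Reducible f → Reducible (k • f)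

  ∫⇒≈ᴹ : ∀ {n} {f g : Free n} → (∀ φ → ∫ f φ ≈ ∫ g φ) → f ⊖ g ∈ I n
  ∫⇒≈ᴹ {f = f} {g} f≈g = ideal-resp
    (λ φ → sym (trans (∫-⊖ f g φ) (x≈y⇒x∙y⁻¹≈ε (f≈g φ)))) zeroᴹ

  reducible-resp : ∀ {n} {f g : Free n} → (∀ φ → ∫ f φ ≈ ∫ g φ) → Reducible f → Reducible g
  reducible-resp {f = f} {g} f≈g = resp (∫⇒≈ᴹ {f = f} {g} f≈g)

  reducible-map : ∀ {m n} (θ : Monomial A m → Monomial A n) →
    (∀ {f} → f ∈ I m → map (map₂ θ) f ∈ I n) →
    (∀ t → Normal (tree t) → Reducible (pure (θ t))) →
    ∀ {f} → Reducible f → Reducible (map (map₂ θ) f)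
  reducible-map θ θ-ideal θ-normal = go
    where
    go : ∀ {f} → Reducible f → Reducible (map (map₂ θ) f)
    go (normal t t∈) = θ-normal t t∈
    go (resp {f} {g} f∼g f∈) = resp
      (ideal-resp (λ φ → begin
        ∫ (map (map₂ θ) (f ⊖ g)) φ                          ≈⟨ trans (∫-map θ (f ⊖ g) φ) (∫-⊖ f g _) ⟩
        ∫ f (φ ∘ θ) - ∫ g (φ ∘ θ)                           ≈⟨ +-cong (∫-map θ f φ) (-‿cong (∫-map θ g φ)) ⟨
        ∫ (map (map₂ θ) f) φ - ∫ (map (map₂ θ) g) φ         ≈⟨ ∫-⊖ (map (map₂ θ) f) (map (map₂ θ) g) φ ⟨
        ∫ (map (map₂ θ) f ⊖ map (map₂ θ) g) φ               ∎)
        (θ-ideal f∼g)) (go f∈)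
    go zeroᴹ = zeroᴹ
    go (plus {f} {g} f∈ g∈) = reducible-resp
      (λ φ → begin
        ∫ (map (map₂ θ) f ++ map (map₂ θ) g) φ              ≈⟨ ∫-++ (map (map₂ θ) f) _ φ ⟩
        ∫ (map (map₂ θ) f) φ + ∫ (map (map₂ θ) g) φ         ≈⟨ +-cong (∫-map θ f φ) (∫-map θ g φ) ⟩
        ∫ f (φ ∘ θ) + ∫ g (φ ∘ θ)                           ≈⟨ trans (∫-map θ (f ++ g) φ) (∫-++ f g _) ⟨
        ∫ (map (map₂ θ) (f ++ g)) φ                         ∎)
      (plus (go f∈) (go g∈))
    go (scale k {f} f∈) = reducible-resp
      (λ φ → begin
        ∫ (k • map (map₂ θ) f) φ                            ≈⟨ ∫-• k (map (map₂ θ) f) φ ⟩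
        k * ∫ (map (map₂ θ) f) φ                            ≈⟨ *-congˡ (∫-map θ f φ) ⟩
        k * ∫ f (φ ∘ θ)                                     ≈⟨ trans (∫-map θ (k • f) φ) (∫-• k f _) ⟨
        ∫ (map (map₂ θ) (k • f)) φ                          ∎)
      (scale k (go f∈))

  reducible-castᵐ : ∀ {m n} (m≡n : m ≡ n) {f : Free m} → Reducible f → Reducible (map (map₂ (castᵐ m≡n)) f)
  reducible-castᵐ ≡.refl {f} = reducible-resp λ φ → sym (∫-map (castᵐ ≡.refl) f φ)

  reducible-labels : ∀ {M n} k (θ : Fin M → Monomial A n) →
    (∀ a → toℕ a < k → Reducible (pure (θ a))) → Reducible (map (map₂ θ) (labels k))
  reducible-labels         zero    θ θ∈ = zeroᴹ
  reducible-labels {zero}  (suc k) θ θ∈ = zeroᴹ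
  reducible-labels {suc M} (suc k) θ θ∈ = reducible-resp
    (λ φ → begin
      ∫ (pure (θ zero) ++ map (map₂ (θ ∘ suc)) (labels k)) φ    ≈⟨ +-congˡ (∫-map (θ ∘ suc) (labels k) φ) ⟩
      1# * φ (θ zero) + ∫ (labels k) (φ ∘ θ ∘ suc)              ≈⟨ +-congˡ (trans (∫-map θ (map (map₂ suc) (labels k)) φ) (∫-map suc (labels k) _)) ⟨
      ∫ (map (map₂ θ) (labels (suc k))) φ                       ∎)
    (plus (θ∈ zero (s≤s z≤n)) (reducible-labels k (θ ∘ suc) λ a a<k → θ∈ (suc a) (s≤s a<k)))

  -- The recursion is that of `⊛`. Normality constrains only left children, so any normal tree may
  -- stand to the right of `u₁` and `y`, and rewriting continues inside `u₂` alone.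
  reducible-branches : ∀ k {u w : T} → Normal u → Normal w → Reducible (branches k u w)
  reducible-branches-root : ∀ k {u w : T} → k ≤root u → Normal u → Normal w → Reducible (branches k u w)

  reducible-branches-root k {u} k≤u u∈ w∈ = reducible-labels k _ λ a a<k →
    normal _ (≤root-weaken a<k u k≤u , u∈ , w∈)

  reducible-branches k {leaf _}       u∈ w∈ = reducible-branches-root k tt u∈ w∈
  reducible-branches k {node u₁ y u₂} {w} u∈@(y<u₁ , u₁∈ , u₂∈) w∈ with ℕₚ.<-≤-connex (toℕ y) k
  ... | inj₂ k≤y = reducible-branches-root k {node u₁ y u₂} k≤y u∈ w∈
  ... | inj₁ y<k = resp (rotation∈ideal y<k u₁ u₂ w)
    (reducible-castᵐ (≡.sym (ℕₚ.+-assoc (#leaves u₁) _ _))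
      (reducible-map (joinʳ u₁ y) (ideal-joinʳ u₁ y)
        (λ t t∈ → normal (joinʳ u₁ y t) (y<u₁ , u₁∈ , t∈))
        (reducible-branches k u₂∈ w∈)))

  reducible-node : ∀ {u w : T} a → Normal u → Normal w → Reducible (pure (node u a w , ≡.refl))
  reducible-node {u} {w} a u∈ w∈ = reducible-resp
    (λ φ → begin
      ∫ (branches (suc (toℕ a)) u w ⊖ branches (toℕ a) u w) φ
        ≈⟨ ∫-⊖ (branches (suc (toℕ a)) u w) (branches (toℕ a) u w) φ ⟩
      ∫ (branches (suc (toℕ a)) u w) φ - ∫ (branches (toℕ a) u w) φ
        ≈⟨ +-cong (trans (∫-branches (suc (toℕ a)) u w φ) (trans (∫-labels-suc a _) (+-comm _ _)))
                  (-‿cong (∫-branches (toℕ a) u w φ)) ⟩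
      φ (node u a w , ≡.refl) + ∫ (labels (toℕ a)) _ - ∫ (labels (toℕ a)) _
        ≈⟨ //-rightDividesʳ _ _ ⟩
      φ (node u a w , ≡.refl)
        ≈⟨ ∫-pure (node u a w , ≡.refl) φ ⟨
      ∫ (pure (node u a w , ≡.refl)) φ ∎)
    (plus (reducible-branches (suc (toℕ a)) u∈ w∈) (scale (- 1#) (reducible-branches (toℕ a) u∈ w∈)))

  -- The left subtree is reduced first, then the right one beside each normal `t` that arises; once
  -- both children are normal, `reducible-node` applies.
  reducible-tree : ∀ (t : T) → Reducible (pure (t , ≡.refl))
  reducible-tree (leaf tt)    = normal (leaf tt , ≡.refl) tt
  reducible-tree (node l a r) =
    reducible-map (joinˡ a r) (ideal-joinˡ a r) graft-r (reducible-tree l)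
    where
    graft-r : ∀ t → Normal (tree t) → Reducible (pure (joinˡ a r t))
    graft-r (t , p) t∈ with recompute (#leaves t ℕₚ.≟ #leaves l) p
    ... | p′ = reducible-castᵐ (≡.cong (ℕ._+ #leaves r) p′)
      (reducible-map (joinʳ t a) (ideal-joinʳ t a) graft-t (reducible-tree r))
      where
      graft-t : ∀ s → Normal (tree s) → Reducible (pure (joinʳ t a s))
      graft-t (s , q) s∈ = reducible-castᵐ (≡.cong (#leaves t ℕ.+_) (recompute (#leaves s ℕₚ.≟ #leaves r) q))
        (reducible-node a t∈ s∈)

  reducible : ∀ {n} (f : Free n) → Reducible f
  reducible []                = zeroᴹ
  reducible {n} ((k , t , p) ∷ f) = reducible-resp
    (λ φ → +-congʳ (*-congʳ (*-identityʳ k)))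
    (plus (scale k (reducible-castᵐ (recompute (#leaves t ℕₚ.≟ n) p) (reducible-tree t))) (reducible f))

  -- Shaped so as to be the same list as the sum in `HasDimension`, which makes `sum≡combination` a
  -- matter of unfolding.
  combination : ∀ {X : Set} {d} → (Fin d → Carrier) → (Fin d → X) → Sums X
  combination {d = zero}  k b = []
  combination {d = suc d} k b = k zero • pure (b zero) ++ combination (k ∘ suc) (b ∘ suc)

  ∫-combination : ∀ {X : Set} {d} k (b : Fin d → X) φ →
                  ∫ (combination k b) φ ≈ ∫ (labels d) (λ i → k i * φ (b i))
  ∫-combination {d = zero}  k b φ = refl
  ∫-combination {d = suc d} k b φ = trans (∫-++ (k zero • pure (b zero)) (combination (k ∘ suc) (b ∘ suc)) φ) (trans
    (+-cong (trans (∫-• (k zero) (pure (b zero)) φ) (*-congˡ (∫-pure (b zero) φ)))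
            (∫-combination (k ∘ suc) (b ∘ suc) φ))
    (sym (∫-labels-∷ d _)))

  module _ {n d : ℕ} (nf : Fin d → Monomial A n) where

    spanning : (∀ t → Normal (tree t) → ∃ λ i → nf i ≡ t) → ∀ {f} → Reducible f →
               ∃ λ k → f ⊖ combination k nf ∈ I n
    spanning complete (normal t t∈) with complete t t∈
    ... | i , ≡.refl = indicator Fin._≟_ i , ∫⇒≈ᴹ {f = pure (nf i)} {combination _ nf} λ φ → sym (begin
      ∫ (combination (indicator Fin._≟_ i) nf) φ
        ≈⟨ ∫-combination (indicator Fin._≟_ i) nf φ ⟩
      ∫ (labels d) (λ j → indicator Fin._≟_ i j * φ (nf j))
        ≈⟨ ∫-labels-single i (Fin.toℕ<n i) _ (λ j j≢i → trans (*-congʳ (indicator-off Fin._≟_ (j≢i ∘ ≡.sym))) (zeroˡ _)) ⟩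
      indicator Fin._≟_ i i * φ (nf i)
        ≈⟨ trans (*-congʳ (indicator-diag Fin._≟_ i)) (sym (+-identityʳ _)) ⟩
      ∫ (pure (nf i)) φ ∎)
    spanning complete (resp {f} {g} f∼g f∈) with spanning complete f∈
    ... | k , f∼s = k , ideal-resp {f = f ⊖ combination k nf ++ (- 1#) • (f ⊖ g)} {g ⊖ combination k nf}
      (λ φ → begin
        ∫ (f ⊖ combination k nf ++ (- 1#) • (f ⊖ g)) φ
          ≈⟨ trans (∫-⊖ (f ⊖ combination k nf) (f ⊖ g) φ) (+-cong (∫-⊖ f (combination k nf) φ) (-‿cong (∫-⊖ f g φ))) ⟩
        (∫ f φ - ∫ (combination k nf) φ) - (∫ f φ - ∫ g φ)
          ≈⟨ [x-z]-[x-y]≈y-z _ _ _ ⟩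
        ∫ g φ - ∫ (combination k nf) φ
          ≈⟨ ∫-⊖ g (combination k nf) φ ⟨
        ∫ (g ⊖ combination k nf) φ ∎)
      (plus f∼s (scale (- 1#) f∼g))
      where
      [x-z]-[x-y]≈y-z : ∀ x y z → (x - z) - (x - y) ≈ y - z
      [x-z]-[x-y]≈y-z x y z = begin
        (x - z) - (x - y)       ≈⟨ +-congˡ (trans (sym (-‿+-comm x (- y))) (trans (+-congˡ (-‿involutive y)) (+-comm _ _))) ⟩
        (x - z) + (y - x)       ≈⟨ sub-telescope z x y ⟩
        y - z                   ∎
    spanning complete zeroᴹ = (λ _ → 0#) , ∫⇒≈ᴹ {f = []} {combination _ nf}
      λ φ → sym (trans (∫-combination (λ _ → 0#) nf φ) (∫-zero (labels d) λ i → zeroˡ _))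
    spanning complete (plus {f} {g} f∈ g∈) with spanning complete f∈ | spanning complete g∈
    ... | k , f∼s | l , g∼s = (λ i → k i + l i) , ideal-resp {f = (f ⊖ s k) ++ (g ⊖ s l)} {(f ++ g) ⊖ s m}
      (λ φ → begin
        ∫ ((f ⊖ s k) ++ (g ⊖ s l)) φ
          ≈⟨ trans (∫-++ (f ⊖ s k) _ φ) (+-cong (∫-⊖ f (s k) φ) (∫-⊖ g (s l) φ)) ⟩
        (∫ f φ - ∫ (s k) φ) + (∫ g φ - ∫ (s l) φ)
          ≈⟨ trans (interchange _ _ _ _) (+-congˡ (-‿+-comm _ _)) ⟩
        (∫ f φ + ∫ g φ) - (∫ (s k) φ + ∫ (s l) φ)
          ≈⟨ +-cong (∫-++ f g φ) (-‿cong (begin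
               ∫ (s m) φ                                              ≈⟨ ∫-combination m nf φ ⟩
               ∫ (labels d) (λ i → (k i + l i) * φ (nf i))            ≈⟨ ∫-cong (labels d) (λ i → distribʳ (φ (nf i)) (k i) (l i)) ⟩
               ∫ (labels d) (λ i → k i * φ (nf i) + l i * φ (nf i))   ≈⟨ ∫-+ (labels d) _ _ ⟩
               ∫ (labels d) (λ i → k i * φ (nf i)) + ∫ (labels d) (λ i → l i * φ (nf i))
                 ≈⟨ +-cong (∫-combination k nf φ) (∫-combination l nf φ) ⟨
               ∫ (s k) φ + ∫ (s l) φ                                  ∎)) ⟨
        ∫ (f ++ g) φ - ∫ (s m) φ
          ≈⟨ ∫-⊖ (f ++ g) (s m) φ ⟨
        ∫ ((f ++ g) ⊖ s m) φ ∎)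
      (plus f∼s g∼s)
      where
      m : Fin d → Carrier
      m i = k i + l i
      s : (Fin d → Carrier) → Free n
      s k = combination k nf
    spanning complete (scale k {f} f∈) with spanning complete f∈
    ... | l , f∼s = (λ i → k * l i) , ideal-resp {f = k • (f ⊖ s l)} {k • f ⊖ s m}
      (λ φ → begin
        ∫ (k • (f ⊖ s l)) φ
          ≈⟨ trans (∫-• k (f ⊖ s l) φ) (*-congˡ (∫-⊖ f (s l) φ)) ⟩
        k * (∫ f φ - ∫ (s l) φ)
          ≈⟨ x[y-z]≈xy-xz k _ _ ⟩
        k * ∫ f φ - k * ∫ (s l) φ
          ≈⟨ +-cong (∫-• k f φ) (-‿cong (begin
               ∫ (s m) φ                                     ≈⟨ ∫-combination m nf φ ⟩
               ∫ (labels d) (λ i → k * l i * φ (nf i))       ≈⟨ ∫-cong (labels d) (λ i → *-assoc k (l i) (φ (nf i))) ⟩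
               ∫ (labels d) (λ i → k * (l i * φ (nf i)))     ≈⟨ ∫-* k (labels d) _ ⟩
               k * ∫ (labels d) (λ i → l i * φ (nf i))       ≈⟨ *-congˡ (∫-combination l nf φ) ⟨
               k * ∫ (s l) φ                                 ∎)) ⟨
        ∫ (k • f) φ - ∫ (s m) φ
          ≈⟨ ∫-⊖ (k • f) (s m) φ ⟨
        ∫ (k • f ⊖ s m) φ ∎)
      (scale k f∼s)
      where
      m : Fin d → Carrier
      m i = k * l i
      s : (Fin d → Carrier) → Free n
      s k = combination k nf

    -- Evaluation on leaves followed by the coordinate at `nf i` kills the ideal, while by
    -- `eval-normal` it is 1 on `nf i` and 0 on every other normal form.
    independent : (∀ i → Normal (tree (nf i))) → (∀ {i j} → tree (nf i) ≡ tree (nf j) → i ≡ j) →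
                  ∀ k → combination k nf ⊖ [] ∈ I n → ∀ i → k i ≈ 0#
    independent nf-normal injective k s∼0 i = begin
      k i
        ≈⟨ trans (*-congˡ (indicator-diag _≟ᵗ_ (tree (nf i)))) (*-identityʳ _) ⟨
      k i * δ (tree (nf i))
        ≈⟨ ∫-labels-single i (Fin.toℕ<n i) _ (λ j j≢i →
             trans (*-congˡ (indicator-off _≟ᵗ_ (j≢i ∘ ≡.sym ∘ injective))) (zeroʳ _)) ⟨
      ∫ (labels d) (λ j → k j * δ (tree (nf j)))
        ≈⟨ ∫-cong (labels d) (λ j → *-congˡ (eval-normal (tree (nf j)) (nf-normal j) δ)) ⟨
      ∫ (labels d) (λ j → k j * ψ (nf j))
        ≈⟨ ∫-combination k nf ψ ⟨
      ∫ (combination k nf) ψ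
        ≈⟨ trans (∫-⊖ (combination k nf) [] ψ) (trans (+-congˡ -0#≈0#) (+-identityʳ _)) ⟨
      ∫ (combination k nf ⊖ []) ψ
        ≈⟨ annihilates-Ideal s∼0 (λ _ → leaf tt) δ ⟩
      0# ∎
      where
      _≟ᵗ_ : DecidableEquality T
      _≟ᵗ_ = ≟-tree Fin._≟_

      δ : T → Carrier
      δ = indicator _≟ᵗ_ (tree (nf i))

      ψ : Monomial A n → Carrier
      ψ t = ∫ (eval (tree t) (λ _ → leaf tt)) δ

    hasDimension : (∀ t → Normal (tree t) → ∃ λ i → nf i ≡ t) →
                   (∀ i → Normal (tree (nf i))) → (∀ {i j} → tree (nf i) ≡ tree (nf j) → i ≡ j) →
                   HasDimension (Hi!ᶜ n) d
    hasDimension complete nf-normal injective = (λ i → pure (nf i))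
      , (λ f → let k , f∼s = spanning complete (reducible f) in
               k , ≡.subst (λ s → f ⊖ s ∈ I n) (≡.sym (sum≡combination k nf)) f∼s)
      , (λ k s∼0 → independent nf-normal injective k
               (≡.subst (λ s → s ⊖ [] ∈ I n) (sum≡combination k nf) s∼0))
      where
      open Module (Hi!ᶜ n) using (+ᴹ-commutativeMonoid)
      open Sum +ᴹ-commutativeMonoid using (sum)

      sum≡combination : ∀ {e} k (b : Fin e → Monomial A n) → sum (λ i → k i • pure (b i)) ≡ combination k b
      sum≡combination {zero}  k b = ≡.refl
      sum≡combination {suc e} k b = ≡.cong (k zero • pure (b zero) ++_) (sum≡combination (k ∘ suc) (b ∘ suc))

-- Counting normal trees

module RaneyNumbers where
  open import Data.Nat.Base using (_+_; _*_)
  open ≡ using (refl; sym; trans; cong; cong₂; subst)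
  open ≡-Reasoning

  -- The number of sequences of r optional (c + 1)-ary trees with n nodes in total:
  -- the first tree is absent, or its root is replaced by its c + 1 optional children.
  raney : ℕ → ℕ → ℕ → ℕ
  raney c zero    zero    = 1
  raney c zero    (suc n) = 0
  raney c (suc r) zero    = raney c r zero
  raney c (suc r) (suc n) = raney c r (suc n) + raney c (suc c + r) n

  C-absorb : ∀ m k → suc k * (suc m C suc k) ≡ suc m * (m C k)
  C-absorb zero    zero    = refl
  C-absorb zero    (suc k) = ℕₚ.*-zeroʳ k
  C-absorb (suc m) zero    = trans (ℕₚ.*-identityˡ _) (trans (nC1≡n (suc (suc m))) (sym (ℕₚ.*-identityʳ _)))
  C-absorb (suc m) (suc k) = begin
    suc (suc k) * (suc (suc m) C suc (suc k))
      ≡⟨ cong (suc (suc k) *_) (nCk+nC[k+1]≡[n+1]C[k+1] (suc m) (suc k)) ⟨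
    suc (suc k) * (x + suc m C suc (suc k))
      ≡⟨ ℕₚ.*-distribˡ-+ (suc (suc k)) x _ ⟩
    x + suc k * x + suc (suc k) * (suc m C suc (suc k))
      ≡⟨ cong₂ (λ y z → x + y + z) (C-absorb m k) (C-absorb m (suc k)) ⟩
    x + suc m * (m C k) + suc m * (m C suc k)
      ≡⟨ ℕₚ.+-assoc x _ _ ⟩
    x + (suc m * (m C k) + suc m * (m C suc k))
      ≡⟨ cong (x +_) (ℕₚ.*-distribˡ-+ (suc m) (m C k) _) ⟨
    x + suc m * (m C k + m C suc k)
      ≡⟨ cong (λ y → x + suc m * y) (nCk+nC[k+1]≡[n+1]C[k+1] m k) ⟩
    suc (suc m) * x ∎
    where x = suc m C suc k

  -- Raney's formula r / ((c + 1) n + r) times a binomial coefficient, multiplied out. In the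
  -- recursive case both smaller instances have the same top entry `M`, so Pascal's rule and
  -- absorption combine them.
  raney-closed : ∀ c r n → raney c r n * (suc c * n + r) ≡ r * ((suc c * n + r) C n)
  raney-closed c zero    zero    = trans (ℕₚ.+-identityʳ _) (trans (ℕₚ.+-identityʳ _) (ℕₚ.*-zeroʳ c))
  raney-closed c zero    (suc n) = refl
  raney-closed c (suc r) zero    = begin
    raney c r 0 * (suc c * 0 + suc r)   ≡⟨ cong (_* (suc c * 0 + suc r)) (raney-zero r) ⟩
    1 * (suc c * 0 + suc r)             ≡⟨ rearrange c r ⟩
    suc r * 1                           ∎
    where
    raney-zero : ∀ r → raney c r 0 ≡ 1
    raney-zero zero    = refl
    raney-zero (suc r) = raney-zero r
    rearrange : ∀ c r → 1 * (suc c * 0 + suc r) ≡ suc r * 1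
    rearrange = solve-∀
  raney-closed c (suc r) (suc n) = ℕₚ.*-cancelʳ-≡ _ _ M (begin
    (f + g) * (suc c * suc n + suc r) * M
      ≡⟨ cong (λ k → (f + g) * k * M) (ℕₚ.+-suc (suc c * suc n) r) ⟩
    (f + g) * suc M * M
      ≡⟨ distribute f g M ⟩
    suc M * (f * M + g * M)
      ≡⟨ cong (λ k → suc M * k) (cong₂ _+_ (raney-closed c r (suc n)) g-closed) ⟩
    suc M * (r * x + (suc c + r) * y)
      -- By `absorbed` the added term equals (c + 1)(n + 1)(x + y). With it on both sides, what
      -- remains is a polynomial identity free of subtraction.
      ≡⟨ ℕₚ.+-cancelʳ-≡ (suc c * suc M * y) _ _ balance ⟩
    suc r * (y + x) * M
      ≡⟨ cong (λ k → suc r * k * M) (nCk+nC[k+1]≡[n+1]C[k+1] M n) ⟩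
    suc r * (suc M C suc n) * M
      ≡⟨ cong (λ k → suc r * (k C suc n) * M) (ℕₚ.+-suc (suc c * suc n) r) ⟨
    suc r * ((suc c * suc n + suc r) C suc n) * M ∎)
    where
    M = suc c * suc n + r
    f = raney c r (suc n)
    g = raney c (suc c + r) n
    x = M C suc n
    y = M C n

    distribute : ∀ f g m → (f + g) * suc m * m ≡ suc m * (f * m + g * m)
    distribute = solve-∀

    shift : ∀ c n r → suc c * n + (suc c + r) ≡ suc c * suc n + r
    shift = solve-∀

    g-closed : g * M ≡ (suc c + r) * y
    g-closed = subst (λ k → g * k ≡ (suc c + r) * (k C n)) (shift c n r) (raney-closed c (suc c + r) n)

    absorbed : suc n * (x + y) ≡ suc M * y
    absorbed = trans (cong (suc n *_) (trans (ℕₚ.+-comm x y) (nCk+nC[k+1]≡[n+1]C[k+1] M n))) (C-absorb M n)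

    expandˡ : ∀ c n r x y → let M = suc c * suc n + r in
      suc M * (r * x + (suc c + r) * y) + suc c * (suc n * (x + y)) ≡ suc r * (y + x) * M + suc c * (suc M * y)
    expandˡ = solve-∀

    balance : suc M * (r * x + (suc c + r) * y) + suc c * suc M * y ≡ suc r * (y + x) * M + suc c * suc M * y
    balance = begin
      suc M * (r * x + (suc c + r) * y) + suc c * suc M * y
        ≡⟨ cong (suc M * (r * x + (suc c + r) * y) +_) (trans (ℕₚ.*-assoc (suc c) (suc M) y) (cong (suc c *_) (sym absorbed))) ⟩
      suc M * (r * x + (suc c + r) * y) + suc c * (suc n * (x + y))
        ≡⟨ expandˡ c n r x y ⟩
      suc r * (y + x) * M + suc c * (suc M * y)
        ≡⟨ cong (suc r * (y + x) * M +_) (ℕₚ.*-assoc (suc c) (suc M) y) ⟨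
      suc r * (y + x) * M + suc c * suc M * y ∎

  C-top : ∀ a n → suc a * (suc (a + n) C n) ≡ suc (a + n) * ((a + n) C n)
  C-top a zero    = cong (λ k → suc k * 1) (sym (ℕₚ.+-identityʳ a))
  C-top a (suc k) = ℕₚ.+-cancelˡ-≡ (suc k * x) _ _ (begin
    suc k * x + suc a * x       ≡⟨ ℕₚ.*-distribʳ-+ x (suc k) (suc a) ⟨
    (suc k + suc a) * x         ≡⟨ cong (_* x) (ℕₚ.+-comm (suc k) (suc a)) ⟩
    suc m * x                   ≡⟨ cong (suc m *_) (nCk+nC[k+1]≡[n+1]C[k+1] m k) ⟨
    suc m * (m C k + y)         ≡⟨ ℕₚ.*-distribˡ-+ (suc m) (m C k) y ⟩
    suc m * (m C k) + suc m * y ≡⟨ cong (_+ suc m * y) (C-absorb m k) ⟨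
    suc k * x + suc m * y       ∎)
    where
    m = a + suc k
    x = suc m C suc k
    y = m C suc k

  -- At r = 1 the closed form has the top entry cn + n + 1, one more than in `cat`; `C-top` converts
  -- one binomial coefficient into the other.
  raney≡cat : ∀ c n → raney c 1 n ≡ cat c n
  raney≡cat c n = ℕₚ.*-cancelʳ-≡ _ _ (suc m) (ℕₚ.*-cancelʳ-≡ _ _ (suc (c * n)) (begin
    raney c 1 n * suc m * suc (c * n)           ≡⟨ cong (_* suc (c * n)) closed ⟩
    (suc m C n) * suc (c * n)                     ≡⟨ ℕₚ.*-comm (suc m C n) (suc (c * n)) ⟩
    suc (c * n) * (suc m C n)                   ≡⟨ C-top (c * n) n ⟩
    suc m * (m C n)                             ≡⟨ cong (suc m *_) (cat-exact c n) ⟨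
    suc m * (cat c n * suc (c * n))             ≡⟨ rearrange (suc m) (cat c n) (suc (c * n)) ⟩
    cat c n * suc m * suc (c * n)               ∎))
    where
    m = c * n + n

    rearrange : ∀ x y z → x * (y * z) ≡ y * x * z
    rearrange = solve-∀

    shift : ∀ c n → suc c * n + 1 ≡ suc (c * n + n)
    shift = solve-∀

    closed : raney c 1 n * suc m ≡ suc m C n
    closed = subst (λ k → raney c 1 n * k ≡ k C n) (shift c n)
      (trans (raney-closed c 1 n) (ℕₚ.*-identityˡ _))

-- Enumeration of normal trees

module Enumeration (c : ℕ) where
  open import Data.Nat.Base using (_+_)
  open ≡ using (refl; sym; trans; cong; cong₂; subst)
  open import Data.Empty using (⊥)
  open ListMembership using (_∈_)
  open RaneyNumbers using (raney; raney≡cat)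

  private
    T = BTree (suc c)

  -- The left spine of a normal tree is a leaf with, for each label, an optional
  -- right subtree.
  build : ∀ {m} → (Fin m → Fin (suc c)) → Vec (Maybe T) m → T
  build label []            = leaf tt
  build label (nothing ∷ v) = build (label ∘ suc) v
  build label (just r ∷ v)  = node (build (label ∘ suc) v) (label zero) r

  plant : ∀ {r} → Vec (Maybe T) (suc c + r) → Vec (Maybe T) (suc r)
  plant v = just (build (λ i → i) (take (suc c) v)) ∷ drop (suc c) v

  -- The clauses are those of `raney`, so the lengths agree by the same recursion. The second
  -- argument counts leaves: `plant` adds exactly one, the end of the new left spine, which stands
  -- for the node of the (c + 1)-ary tree.
  forests : ∀ r → ℕ → List (Vec (Maybe T) r)
  forests zero    zero    = [] ∷ []
  forests zero    (suc n) = []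
  forests (suc r) zero    = map (nothing ∷_) (forests r zero)
  forests (suc r) (suc n) = map (nothing ∷_) (forests r (suc n)) ++ map plant (forests (suc c + r) n)

  length-forests : ∀ r n → length (forests r n) ≡ raney c r n
  length-forests zero    zero    = refl
  length-forests zero    (suc n) = refl
  length-forests (suc r) zero    = trans (List.length-map _ (forests r zero)) (length-forests r zero)
  length-forests (suc r) (suc n) = trans (List.length-++ (map (nothing ∷_) (forests r (suc n))))
    (cong₂ _+_ (trans (List.length-map _ (forests r (suc n))) (length-forests r (suc n)))
               (trans (List.length-map _ (forests (suc c + r) n)) (length-forests (suc c + r) n)))

  -- Dropping the first slot of a spine shifts the labelling, so recursion meets labellings that
  -- start at an arbitrary `k`.
  Increasing : ∀ {m} → ℕ → (Fin m → Fin (suc c)) → Set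
  Increasing k label = ∀ i → toℕ (label i) ≡ k + toℕ i

  increasing-tail : ∀ {m k} {label : Fin (suc m) → Fin (suc c)} → Increasing k label → Increasing (suc k) (label ∘ suc)
  increasing-tail {k = k} inc i = trans (inc (suc i)) (ℕₚ.+-suc k (toℕ i))

  increasing-head : ∀ {m k} {label : Fin (suc m) → Fin (suc c)} → Increasing k label → toℕ (label zero) ≡ k
  increasing-head inc = trans (inc zero) (ℕₚ.+-identityʳ _)

  size : ∀ {r} → Vec (Maybe T) r → ℕ
  size []            = 0
  size (nothing ∷ v) = size v
  size (just t ∷ v)  = #leaves t + size v

  AllNormal : ∀ {r} → Vec (Maybe T) r → Set
  AllNormal = Allᵛ.All (Allᵐ.All Normal)

  size-++ : ∀ {m r} (v : Vec (Maybe T) m) (w : Vec (Maybe T) r) → size (v Vec.++ w) ≡ size v + size w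
  size-++ []            w = refl
  size-++ (nothing ∷ v) w = size-++ v w
  size-++ (just t ∷ v)  w = trans (cong (#leaves t +_) (size-++ v w)) (sym (ℕₚ.+-assoc (#leaves t) _ _))

  #leaves-build : ∀ {m} label (v : Vec (Maybe T) m) → #leaves (build label v) ≡ suc (size v)
  #leaves-build label []            = refl
  #leaves-build label (nothing ∷ v) = #leaves-build (label ∘ suc) v
  #leaves-build label (just r ∷ v)  = trans (cong (_+ #leaves r) (#leaves-build (label ∘ suc) v))
    (cong suc (ℕₚ.+-comm (size v) _))

  root-build : ∀ {m k label} → Increasing k label → (v : Vec (Maybe T) m) → k ≤root build label v
  root-build                   inc []            = tt
  root-build {k = k} {label}   inc (nothing ∷ v) =
    ≤root-weaken (ℕₚ.n≤1+n k) (build (label ∘ suc) v) (root-build (increasing-tail inc) v)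
  root-build                   inc (just r ∷ v)  = ℕₚ.≤-reflexive (sym (increasing-head inc))

  normal-build : ∀ {m k label} → Increasing k label → {v : Vec (Maybe T) m} → AllNormal v → Normal (build label v)
  normal-build inc []              = tt
  normal-build inc (nothing ∷ v∈)  = normal-build (increasing-tail inc) v∈
  normal-build {label = label} inc {just r ∷ v} (just r∈ ∷ v∈) =
      subst (λ j → suc j ≤root build (label ∘ suc) v) (sym (increasing-head inc)) (root-build (increasing-tail inc) v)
    , normal-build (increasing-tail inc) v∈ , r∈

  -- The root reveals whether the first slot is filled: its label is then `k`, while with an empty
  -- slot the tree is a leaf or has a larger root label.
  build-injective : ∀ {m k label} → Increasing k label → (v w : Vec (Maybe T) m) →
                    build label v ≡ build label w → v ≡ w
  build-injective inc []            []            _  = refl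
  build-injective inc (nothing ∷ v) (nothing ∷ w) eq = cong (nothing ∷_) (build-injective (increasing-tail inc) v w eq)
  build-injective {label = label} inc (nothing ∷ v) (just r ∷ w) eq = contradiction
    (subst (_ ≤root_) eq (root-build (increasing-tail inc) v)) (ℕₚ.<⇒≱ (s≤s (ℕₚ.≤-reflexive (increasing-head inc))))
  build-injective inc (just r ∷ v) (nothing ∷ w) eq = contradiction
    (subst (_ ≤root_) (sym eq) (root-build (increasing-tail inc) w)) (ℕₚ.<⇒≱ (s≤s (ℕₚ.≤-reflexive (increasing-head inc))))
  build-injective {label = label} inc (just r ∷ v) (just s ∷ w) eq =
    cong₂ _∷_ (cong just (node-injʳ eq)) (build-injective (increasing-tail inc) v w (node-injˡ eq))
    where
    node-injˡ : ∀ {l l′ r r′ : T} {x x′} → node l x r ≡ node l′ x′ r′ → l ≡ l′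
    node-injˡ refl = refl
    node-injʳ : ∀ {l l′ r r′ : T} {x x′} → node l x r ≡ node l′ x′ r′ → r ≡ r′
    node-injʳ refl = refl

  increasing-id : Increasing 0 (λ i → i)
  increasing-id i = refl

  -- The equation k + m = c + 1 says that exactly the labels from `k` to `c` remain for the spine.
  -- When none remain, the bound on the root leaves only a leaf.
  decompose : ∀ m {k} {label : Fin m → Fin (suc c)} → Increasing k label → k + m ≡ suc c →
              ∀ t → k ≤root t → Normal t → ∃ λ v → build label v ≡ t × AllNormal v
  decompose zero    inc k+0≡1+c (leaf tt)    _   _ = [] , refl , []
  decompose zero    inc k+0≡1+c (node _ a _) k≤a _ = contradiction (Fin.toℕ<n a)
    (ℕₚ.≤⇒≯ (subst (_≤ toℕ a) (trans (sym (ℕₚ.+-identityʳ _)) k+0≡1+c) k≤a))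
  decompose (suc m) {k} {label} inc k+m≡c t k≤t t∈ = cases t k≤t t∈
    where
    k+1+m≡c : suc k + m ≡ suc c
    k+1+m≡c = trans (sym (ℕₚ.+-suc k m)) k+m≡c

    skip : ∀ t → suc k ≤root t → Normal t → ∃ λ v → build label v ≡ t × AllNormal v
    skip t k<t t∈ with decompose m (increasing-tail inc) k+1+m≡c t k<t t∈
    ... | v , eq , v∈ = nothing ∷ v , eq , nothing ∷ v∈

    cases : ∀ t → k ≤root t → Normal t → ∃ λ v → build label v ≡ t × AllNormal v
    cases (leaf x)     k≤t t∈ = skip (leaf x) tt t∈
    cases (node l a r) k≤a t∈@(a<l , l∈ , r∈) with ℕₚ.m≤n⇒m<n∨m≡n k≤a
    ... | inj₁ k<a = skip (node l a r) k<a t∈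
    ... | inj₂ k≡a with decompose m (increasing-tail inc) k+1+m≡c l (subst (λ j → suc j ≤root l) (sym k≡a) a<l) l∈
    ... | v , eq , v∈ = just r ∷ v
      , cong₂ (λ l a → node l a r) eq (Fin.toℕ-injective (trans (increasing-head inc) k≡a)) , just r∈ ∷ v∈

  decompose-id : ∀ {t} → Normal t → ∃ λ v → build (λ i → i) v ≡ t × AllNormal v
  decompose-id {leaf _}     = decompose (suc c) increasing-id refl _ tt
  decompose-id {node _ _ _} = decompose (suc c) increasing-id refl _ z≤n

  plant-++ : ∀ {r} (v : Vec (Maybe T) (suc c)) (w : Vec (Maybe T) r) → plant (v Vec.++ w) ≡ just (build (λ i → i) v) ∷ w
  plant-++ v w with Vec.++-injective (take (suc c) (v Vec.++ w)) v (Vec.take++drop≡id (suc c) (v Vec.++ w))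
  ... | take≡v , drop≡w = cong₂ (λ v w → just (build (λ i → i) v) ∷ w) take≡v drop≡w

  plant-injective : ∀ {r} {v w : Vec (Maybe T) (suc c + r)} → plant v ≡ plant w → v ≡ w
  plant-injective {v = v} {w} eq = begin
    v                                                 ≡⟨ Vec.take++drop≡id (suc c) v ⟨
    take (suc c) v Vec.++ drop (suc c) v              ≡⟨ cong₂ Vec._++_
      (build-injective increasing-id _ _ (just-injective (Vec.∷-injectiveˡ eq))) (Vec.∷-injectiveʳ eq) ⟩
    take (suc c) w Vec.++ drop (suc c) w              ≡⟨ Vec.take++drop≡id (suc c) w ⟩
    w                                                 ∎
    where open ≡-Reasoning

  forests-unique : ∀ r n → Unique (forests r n)
  forests-unique zero    zero    = [] ∷ []
  forests-unique zero    (suc n) = []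
  forests-unique (suc r) zero    = Unique.map⁺ Vec.∷-injectiveʳ (forests-unique r zero)
  forests-unique (suc r) (suc n) = Unique.++⁺
    (Unique.map⁺ Vec.∷-injectiveʳ (forests-unique r (suc n)))
    (Unique.map⁺ plant-injective (forests-unique (suc c + r) n))
    λ (v∈ˡ , v∈ʳ) → disjoint (∈-map⁻ (nothing ∷_) v∈ˡ) (∈-map⁻ plant v∈ʳ)
    where
    disjoint : ∀ {v : Vec (Maybe T) (suc r)} {xs : List (Vec (Maybe T) r)} {ys} →
               (∃ λ x → x ∈ xs × v ≡ nothing ∷ x) → (∃ λ y → y ∈ ys × v ≡ plant y) → ⊥
    disjoint (_ , _ , refl) (_ , _ , ())

  Fits : ∀ {r} → ℕ → Vec (Maybe T) r → Set
  Fits n v = size v ≡ n × AllNormal v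

  plant-fits : ∀ {r n} {v : Vec (Maybe T) (suc c + r)} → Fits n v → Fits (suc n) (plant v)
  plant-fits {v = v} (size≡n , v∈) = trans (cong (_+ size w₂) (#leaves-build (λ i → i) w₁))
      (cong suc (trans (sym (size-++ w₁ w₂)) (trans (cong size w₁++w₂≡v) size≡n)))
    , just (normal-build increasing-id (AllᵛP.++ˡ⁻ w₁ w∈)) ∷ AllᵛP.++ʳ⁻ w₁ w∈
    where
    w₁ = take (suc c) v
    w₂ = drop (suc c) v
    w₁++w₂≡v : w₁ Vec.++ w₂ ≡ v
    w₁++w₂≡v = Vec.take++drop≡id (suc c) v
    w∈ : AllNormal (w₁ Vec.++ w₂)
    w∈ = subst AllNormal (sym w₁++w₂≡v) v∈

  forests-fit : ∀ r n → All (Fits n) (forests r n)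
  forests-fit zero    zero    = (refl , []) ∷ []
  forests-fit zero    (suc n) = []
  forests-fit (suc r) zero    = AllP.map⁺ (All.map (λ (s , v∈) → s , nothing ∷ v∈) (forests-fit r zero))
  forests-fit (suc r) (suc n) = AllP.++⁺
    (AllP.map⁺ (All.map (λ (s , v∈) → s , nothing ∷ v∈) (forests-fit r (suc n))))
    (AllP.map⁺ (All.map plant-fits (forests-fit (suc c + r) n)))

  -- Decomposing a present tree uses up the leaf at the end of its spine, so `n` drops even though
  -- the number of slots grows; an absent tree lowers `r` at the same `n`.
  ∈-forests : ∀ r n {v : Vec (Maybe T) r} → Fits n v → v ∈ forests r n
  ∈-forests zero    zero    {[]}          _                    = here refl
  ∈-forests (suc r) zero    {nothing ∷ v} (s , nothing ∷ v∈)   = ∈-map⁺ (nothing ∷_) (∈-forests r zero (s , v∈))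
  ∈-forests (suc r) zero    {just t ∷ v}  (s , _)              =
    contradiction (subst (1 ≤_) (ℕₚ.m+n≡0⇒m≡0 (#leaves t) s) (1≤#leaves t)) λ ()
  ∈-forests (suc r) (suc n) {nothing ∷ v} (s , nothing ∷ v∈)   =
    ∈-++⁺ˡ (∈-map⁺ (nothing ∷_) (∈-forests r (suc n) (s , v∈)))
  ∈-forests (suc r) (suc n) {just t ∷ v}  (s , just t∈ ∷ v∈) with decompose-id t∈
  ... | w , refl , w∈ = ∈-++⁺ʳ (map (nothing ∷_) (forests r (suc n)))
    (subst (_∈ map plant (forests (suc c + r) n)) (plant-++ w v) (∈-map⁺ plant (∈-forests (suc c + r) n
      (trans (size-++ w v) (ℕₚ.suc-injective (trans (cong (_+ size v) (sym (#leaves-build (λ i → i) w))) s)) , AllᵛP.++⁺ w∈ v∈))))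

  -- The trees listed have n + 1 leaves: `n` counts those in the slots, and the end of the spine is
  -- one more.
  normalTrees : ℕ → List T
  normalTrees n = map (build (λ i → i)) (forests (suc c) n)

  length-normalTrees : ∀ n → length (normalTrees n) ≡ cat c (suc n)
  length-normalTrees n = begin
    length (normalTrees n)        ≡⟨ List.length-map _ (forests (suc c) n) ⟩
    length (forests (suc c) n)    ≡⟨ length-forests (suc c) n ⟩
    raney c (suc c) n             ≡⟨ cong (λ r → raney c r n) (ℕₚ.+-identityʳ (suc c)) ⟨
    -- A single optional tree with at least one node must be present, so this term unfolds to the
    -- count for its c + 1 root slots.
    raney c 1 (suc n)             ≡⟨ raney≡cat c (suc n) ⟩
    cat c (suc n)                 ∎
    where open ≡-Reasoning

  normalTrees-unique : ∀ n → Unique (normalTrees n)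
  normalTrees-unique n = Unique.map⁺ (build-injective increasing-id _ _) (forests-unique (suc c) n)

  normalTrees-normal : ∀ n → All (λ t → #leaves t ≡ suc n × Normal t) (normalTrees n)
  normalTrees-normal n = AllP.map⁺ (All.map
    (λ {v} (s , v∈) → trans (#leaves-build (λ i → i) v) (cong suc s) , normal-build increasing-id v∈)
    (forests-fit (suc c) n))

  ∈-normalTrees : ∀ {n t} → #leaves t ≡ suc n → Normal t → t ∈ normalTrees n
  ∈-normalTrees {n} t≡1+n t∈ with decompose-id t∈
  ... | v , refl , v∈ = ∈-map⁺ (build (λ i → i)) (∈-forests (suc c) n
    (ℕₚ.suc-injective (trans (sym (#leaves-build (λ i → i) v)) t≡1+n) , v∈))

lookup-injective : ∀ {X : Set} {xs : List X} → Unique xs → ∀ {i j} → lookup xs i ≡ lookup xs j → i ≡ j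
lookup-injective {xs = _ ∷ _}  _           {zero}  {zero}  _  = ≡.refl
lookup-injective {xs = _ ∷ xs} (x∉xs ∷ _)  {zero}  {suc j} eq = contradiction eq (All.lookup x∉xs (∈-lookup j))
lookup-injective {xs = _ ∷ xs} (x∉xs ∷ _)  {suc i} {zero}  eq = contradiction (≡.sym eq) (All.lookup x∉xs (∈-lookup i))
lookup-injective {xs = _ ∷ _}  (_ ∷ uniq)  {suc i} {suc j} eq = ≡.cong suc (lookup-injective uniq eq)

proposition4p2p5 : ∀ {k ℓ₁ ℓ₂} (K : HeytingField k ℓ₁ ℓ₂) → CharacteristicZero K →
    ∀ (c n : ℕ) → n ≥ 1 → HasDimension (Hi! K c n) (cat c n)
proposition4p2p5 K _ c (suc n) _ = ≡.subst (HasDimension (Hi! K c (suc n))) (length-normalTrees n)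
  (hasDimension nf complete (λ i → proj₂ (nf-normal i)) (lookup-injective (normalTrees-unique n)))
  where
  open Enumeration c
  open Spanning (fieldRing K) c

  nf-normal : ∀ i → #leaves (lookup (normalTrees n) i) ≡ suc n × Normal (lookup (normalTrees n) i)
  nf-normal i = All.lookup (normalTrees-normal n) (∈-lookup i)

  nf : Fin (length (normalTrees n)) → Monomial (Fin (suc c)) (suc n)
  nf i = lookup (normalTrees n) i , proj₁ (nf-normal i)

  complete : ∀ t → Normal (Monomial.tree t) → ∃ λ i → nf i ≡ t
  complete (t , p) t∈ = Any.index t∈nf , ≡.sym (monomial≡ (AnyP.lookup-index t∈nf))
    where
    t∈nf : t ListMembership.∈ normalTrees n
    t∈nf = ∈-normalTrees (recompute (#leaves t ℕₚ.≟ suc n) p) t∈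

    monomial≡ : ∀ {s} .{q : #leaves s ≡ suc n} → t ≡ s → _≡_ {A = Monomial (Fin (suc c)) (suc n)} (t , p) (s , q)
    monomial≡ ≡.refl = ≡.refl
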